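{- Let $\Delta=\Delta(m)$ be a function of the positive integer $m$ with $\Delta(m)\to\infty$ as $m\to\infty$, and let $S$ be any integer. Then the set $$\Big\{qy\pmod m:\ 1\le q\le m^{1/2},\ q \text{ prime},\ S+1\le y\le S+\Delta\, m^{1/2}\sqrt{m/\phi(m)}\,\log m\Big\}$$ (with $y$ an integer) contains $(1+O(\Delta^{ -1}))\,m$ residue classes modulo $m$.
   Context: $\phi$ is Euler's totient function. The statement is asymptotic as $m\to\infty$ (i.e. for all sufficiently large $m$), and the constant implied by $O$ is uniform in $m$ and $S$ ($S$ may depend on $m$). -}

module Defs where

open import Data.Nat.Base as ℕ using (ℕ; zero; suc)
import Data.Nat.Properties as ℕ
open import Data.Nat.Coprimality using (coprime?; 1-coprimeTo)
open import Data.Nat.Primality using (Prime)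
open import Data.Integer.Base as ℤ using (ℤ; +_; +[1+_]; -[1+_])
import Data.Integer.Properties as ℤ
open import Data.Integer.DivMod using (_%ℕ_)
import Data.Rational.Unnormalised.Base as ℚᵘ
import Data.Rational.Unnormalised.Properties as ℚᵘ
open import Data.Rational.Base
open import Data.Rational.Properties
open import Data.Rational.Literals using (fromℤ)
open import Data.Rational.Solver using (module +-*-Solver)
open import Data.Fin.Base using (Fin; zero; suc; toℕ)
open import Data.Fin.Subset using (Subset; inside; outside; _∈_) renaming (∣_∣ to card)
open import Data.Vec.Base using ([]; _∷_; here; there)
open import Data.List.Base using (length; filter; applyUpTo)
open import Data.List.Properties using (filter-accept)
open import Data.Product.Base using (∃; ∃₂; _×_; _,_; proj₁; proj₂)
open import Data.Sum.Base using (inj₁; inj₂)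
open import Function.Bundles using (_⇔_; mk⇔; Equivalence)
open import Relation.Nullary using (¬_; yes; no)
open import Relation.Nullary.Negation using (contradiction)
open import Relation.Binary.PropositionalEquality using (_≡_; refl; sym; trans; cong; cong₂; subst; module ≡-Reasoning)
open +-*-Solver

infix  4 _≃ʳ_ _≤ʳ_ _<ʳ_
infixl 6 _+ʳ_
infixl 7 _*ʳ_
infix  8 _⁻¹[_]

module RationalLemmas where

  fromℕ : ℕ → ℚ
  fromℕ n = fromℤ (+ n)

  fromℕ-+ : ∀ m n → fromℕ (m ℕ.+ n) ≡ fromℕ m + fromℕ n
  fromℕ-+ m n = toℚᵘ-injective (ℚᵘ.≃-trans
    (ℚᵘ.*≡* (cong (ℤ._* + 1) (sym (cong₂ ℤ._+_ (ℤ.*-identityʳ (+ m)) (ℤ.*-identityʳ (+ n))))))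
    (ℚᵘ.≃-sym (toℚᵘ-homo-+ (fromℕ m) (fromℕ n))))

  fromℕ-* : ∀ m n → fromℕ (m ℕ.* n) ≡ fromℕ m * fromℕ n
  fromℕ-* m n = toℚᵘ-injective (ℚᵘ.≃-trans
    (ℚᵘ.*≡* (cong (ℤ._* + 1) (ℤ.pos-* m n)))
    (ℚᵘ.≃-sym (toℚᵘ-homo-* (fromℕ m) (fromℕ n))))

  fromℕ-mono : ∀ {m n} → m ℕ.≤ n → fromℕ m ≤ fromℕ n
  fromℕ-mono m≤n = *≤* (ℤ.*-monoʳ-≤-nonNeg (+ 1) (ℤ.+≤+ m≤n))

  /-* : ∀ i d .{{_ : ℕ.NonZero d}} → (i / d) * fromℕ d ≡ fromℤ i
  /-* i (suc d) = toℚᵘ-injective (ℚᵘ.≃-trans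
    (toℚᵘ-homo-* (i / suc d) (fromℕ (suc d)))
    (ℚᵘ.≃-trans (ℚᵘ.*-congʳ {x = ℚᵘ.mkℚᵘ (+ suc d) 0} (toℚᵘ-fromℚᵘ (ℚᵘ.mkℚᵘ i d)))
      (ℚᵘ.*≡* (trans (ℤ.*-identityʳ _) (cong (λ e → i ℤ.* + suc e) (sym (ℕ.*-identityʳ d)))))))

  ↥-↧ : ∀ p → p * fromℕ (↧ₙ p) ≡ fromℤ (↥ p)
  ↥-↧ p@record{} = trans (cong (_* fromℕ (↧ₙ p)) (sym (↥p/↧p≡p p))) (/-* (↥ p) (↧ₙ p))

  *-mono-≤-nonNeg : ∀ {p q r s} → 0ℚ ≤ p → 0ℚ ≤ s → p ≤ q → r ≤ s → p * r ≤ q * s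
  *-mono-≤-nonNeg {p} {q} {r} {s} 0≤p 0≤s p≤q r≤s = ≤-trans
    (*-monoˡ-≤-nonNeg p {{nonNegative 0≤p}} r≤s)
    (*-monoʳ-≤-nonNeg s {{nonNegative 0≤s}} p≤q)

  *-nonNeg : ∀ {p q} → 0ℚ ≤ p → 0ℚ ≤ q → 0ℚ ≤ p * q
  *-nonNeg {p} {q} 0≤p 0≤q =
    nonNegative⁻¹ (p * q) {{nonNeg*nonNeg⇒nonNeg p {{nonNegative 0≤p}} q {{nonNegative 0≤q}}}}

  *-pos : ∀ {p q} → 0ℚ < p → 0ℚ < q → 0ℚ < p * q
  *-pos {p} {q} 0<p 0<q =
    positive⁻¹ (p * q) {{pos*pos⇒pos p {{positive 0<p}} q {{positive 0<q}}}}

  +-nonNeg : ∀ {p q} → 0ℚ ≤ p → 0ℚ ≤ q → 0ℚ ≤ p + q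
  +-nonNeg 0≤p 0≤q = ≤-trans (≤-reflexive (sym (+-identityˡ 0ℚ))) (+-mono-≤ 0≤p 0≤q)

  p≤p+q : ∀ {p q} → 0ℚ ≤ q → p ≤ p + q
  p≤p+q {p} 0≤q = ≤-trans (≤-reflexive (sym (+-identityʳ p))) (+-monoʳ-≤ p 0≤q)

  ½-pos : ∀ {ε} → 0ℚ < ε → 0ℚ < ε * ½
  ½-pos 0<ε = *-pos 0<ε (positive⁻¹ ½)

  halves : ∀ ε → ε * ½ + ε * ½ ≡ ε
  halves ε = trans (sym (*-distribˡ-+ ε ½ ½)) (*-identityʳ ε)

  p≤∣p∣ : ∀ p → p ≤ ∣ p ∣
  p≤∣p∣ p with ≤-total 0ℚ p
  ... | inj₁ 0≤p = ≤-reflexive (sym (0≤p⇒∣p∣≡p 0≤p))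
  ... | inj₂ p≤0 = ≤-trans p≤0 (0≤∣p∣ p)

  ∣p-q∣≤⇒≤ : ∀ {p q ε} → ∣ p - q ∣ ≤ ε → p ≤ q + ε
  ∣p-q∣≤⇒≤ {p} {q} {ε} h = ≤-trans
    (≤-reflexive (solve 2 (λ p q → p := q :+ (p :- q)) refl p q))
    (+-monoʳ-≤ q (≤-trans (p≤∣p∣ (p - q)) h))

  p-q≤ : ∀ {p q ε} → p ≤ q + ε → p - q ≤ ε
  p-q≤ {p} {q} {ε} h = ≤-trans (+-monoˡ-≤ (- q) h)
    (≤-reflexive (solve 2 (λ q e → (q :+ e) :- q := e) refl q ε))

  ≤⇒∣p-q∣≤ : ∀ {p q ε} → p ≤ q + ε → q ≤ p + ε → ∣ p - q ∣ ≤ ε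
  ≤⇒∣p-q∣≤ {p} {q} h h′ with ∣p∣≡p∨∣p∣≡-p (p - q)
  ... | inj₁ eq = ≤-trans (≤-reflexive eq) (p-q≤ h)
  ... | inj₂ eq = ≤-trans
    (≤-reflexive (trans eq (solve 2 (λ p q → :- (p :- q) := q :- p) refl p q))) (p-q≤ h′)

  square-cancel-≤ : ∀ {p q} → 0ℚ ≤ q → p * p ≤ q * q → p ≤ q
  square-cancel-≤ {p} {q} 0≤q h with p ≤? q
  ... | yes p≤q = p≤q
  ... | no p≰q = contradiction
    (<-≤-trans (*-monoʳ-<-pos p {{positive 0<p}} q<p) h)
    (λ pq<qq → <-irrefl refl (<-≤-trans pq<qq
      (*-monoʳ-≤-nonNeg q {{nonNegative 0≤q}} (<⇒≤ q<p))))
    where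
    q<p : q < p
    q<p = ≰⇒> p≰q
    0<p : 0ℚ < p
    0<p = ≤-<-trans 0≤q q<p

open RationalLemmas

-- n ↦ 1/(n+1), not 1/n
recip : ℕ → ℚ
recip n = 1/ fromℤ (+ suc n)

module RecipLemmas where

  recip-pos : ∀ n → 0ℚ < recip n
  recip-pos n = positive⁻¹ (recip n)

  recip-* : ∀ n → recip n * fromℕ (suc n) ≡ 1ℚ
  recip-* n = *-inverseˡ (fromℕ (suc n))

  recip-anti : ∀ {m n} → m ℕ.≤ n → recip n ≤ recip m
  recip-anti {m} {n} m≤n = *≤* (ℤ.*-monoˡ-≤-nonNeg (+ 1) (ℤ.+≤+ (ℕ.s≤s m≤n)))

  archimedean : ∀ ε → 0ℚ < ε → ∃ λ N → ∀ n → N ℕ.≤ n → recip n ≤ ε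
  archimedean (mkℚ (+ zero) d _)  (*<* (ℤ.+<+ ()))
  archimedean (mkℚ -[1+ _ ] d _)  (*<* ())
  archimedean (mkℚ +[1+ a ] d _) _ = d , λ n d≤n → ≤-trans (recip-anti d≤n)
    (*≤* (ℤ.*-monoʳ-≤-nonNeg (+ suc d) {+ 1} {+[1+ a ]} (ℤ.+≤+ (ℕ.s≤s ℕ.z≤n))))

open RecipLemmas

IsCauchy : (ℕ → ℚ) → Set
IsCauchy s = ∀ ε → 0ℚ < ε → ∃ λ N → ∀ m n → N ℕ.≤ m → N ℕ.≤ n → ∣ s m - s n ∣ ≤ ε

record ℝ : Set where
  constructor mkℝ
  field
    seq    : ℕ → ℚ
    cauchy : IsCauchy seq

open ℝ public

_≃ʳ_ _≤ʳ_ _<ʳ_ : ℝ → ℝ → Set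
x ≃ʳ y = ∀ ε → 0ℚ < ε → ∃ λ N → ∀ n → N ℕ.≤ n → ∣ seq x n - seq y n ∣ ≤ ε
x ≤ʳ y = ∀ ε → 0ℚ < ε → ∃ λ N → ∀ n → N ℕ.≤ n → seq x n ≤ seq y n + ε
x <ʳ y = ∃ λ ε → 0ℚ < ε × ∃ λ N → ∀ n → N ℕ.≤ n → seq x n + ε ≤ seq y n

module CauchyLemmas where

  oneSided : ∀ {s} →
    (∀ ε → 0ℚ < ε → ∃ λ N → ∀ m n → N ℕ.≤ m → N ℕ.≤ n → s m ≤ s n + ε) → IsCauchy s
  oneSided h ε 0<ε = let N , H = h ε 0<ε in
    N , λ m n N≤m N≤n → ≤⇒∣p-q∣≤ (H m n N≤m N≤n) (H n m N≤n N≤m)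

  ⊔-≤ˡ : ∀ {m n o} → m ℕ.⊔ n ℕ.≤ o → m ℕ.≤ o
  ⊔-≤ˡ {m} {n} = ℕ.≤-trans (ℕ.m≤m⊔n m n)

  ⊔-≤ʳ : ∀ {m n o} → m ℕ.⊔ n ℕ.≤ o → n ℕ.≤ o
  ⊔-≤ʳ {m} {n} = ℕ.≤-trans (ℕ.m≤n⊔m m n)

open CauchyLemmas

fromℚ : ℚ → ℝ
fromℚ q = mkℝ (λ _ → q) λ ε 0<ε → 0 , λ _ _ _ _ →
  ≤-trans (≤-reflexive (cong ∣_∣ (+-inverseʳ q))) (<⇒≤ 0<ε)

ℤ→ℝ : ℤ → ℝ
ℤ→ℝ i = fromℚ (fromℤ i)

ℕ→ℝ : ℕ → ℝ
ℕ→ℝ n = ℤ→ℝ (+ n)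

0ʳ 1ʳ : ℝ
0ʳ = ℕ→ℝ 0
1ʳ = ℕ→ℝ 1

_+ʳ_ : ℝ → ℝ → ℝ
x +ʳ y = mkℝ (λ n → seq x n + seq y n) λ ε 0<ε →
  let N₁ , H₁ = cauchy x (ε * ½) (½-pos 0<ε)
      N₂ , H₂ = cauchy y (ε * ½) (½-pos 0<ε)
  in N₁ ℕ.⊔ N₂ , λ m n N≤m N≤n →
    let a = seq x m ; b = seq y m ; c = seq x n ; d = seq y n in
    ≤-trans (≤-reflexive (cong ∣_∣
      (solve 4 (λ a b c d → (a :+ b) :- (c :+ d) := (a :- c) :+ (b :- d)) refl a b c d)))
    (≤-trans (∣p+q∣≤∣p∣+∣q∣ (a - c) (b - d))
    (≤-trans (+-mono-≤ (H₁ m n (⊔-≤ˡ N≤m) (⊔-≤ˡ N≤n))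
                       (H₂ m n (⊔-≤ʳ {N₁} N≤m) (⊔-≤ʳ {N₁} N≤n)))
    (≤-reflexive (halves ε))))

∣_∣ʳ : ℝ → ℝ
∣ x ∣ʳ = mkℝ (λ n → ∣ seq x n ∣) (oneSided λ ε 0<ε →
  let N , H = cauchy x ε 0<ε in
  N , λ m n N≤m N≤n →
    let a = seq x m ; b = seq x n in
    ≤-trans (≤-reflexive (cong ∣_∣ (solve 2 (λ a b → a := b :+ (a :- b)) refl a b)))
    (≤-trans (∣p+q∣≤∣p∣+∣q∣ b (a - b)) (+-monoʳ-≤ ∣ b ∣ (H m n N≤m N≤n))))

module ProductLemmas where

  eventuallyBounded : ∀ x → ∃ λ B → 0ℚ < B × ∃ λ N → ∀ n → N ℕ.≤ n → ∣ seq x n ∣ ≤ B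
  eventuallyBounded x =
    let N , H = cauchy x 1ℚ (positive⁻¹ 1ℚ)
        b = seq x N
    in ∣ b ∣ + 1ℚ
     , <-≤-trans (positive⁻¹ 1ℚ)
         (≤-trans (p≤p+q (0≤∣p∣ b)) (≤-reflexive (+-comm 1ℚ ∣ b ∣)))
     , N
     , λ n N≤n → let a = seq x n in
         ≤-trans (≤-reflexive (cong ∣_∣ (solve 2 (λ a b → a := b :+ (a :- b)) refl a b)))
         (≤-trans (∣p+q∣≤∣p∣+∣q∣ b (a - b)) (+-monoʳ-≤ ∣ b ∣ (H n N N≤n ℕ.≤-refl)))

  *-cauchy : ∀ x y → IsCauchy (λ n → seq x n * seq y n)
  *-cauchy x y ε 0<ε = N , bound
    where
    Bx = proj₁ (eventuallyBounded x)
    By = proj₁ (eventuallyBounded y)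
    0<Bx : 0ℚ < Bx
    0<Bx = proj₁ (proj₂ (eventuallyBounded x))
    0<By : 0ℚ < By
    0<By = proj₁ (proj₂ (eventuallyBounded y))
    0<B : 0ℚ < Bx + By
    0<B = <-≤-trans 0<Bx (p≤p+q (<⇒≤ 0<By))
    B⁻¹ : ℚ
    B⁻¹ = (1/ (Bx + By)) {{>-nonZero 0<B}}
    δ : ℚ
    δ = ε * B⁻¹
    0<δ : 0ℚ < δ
    0<δ = *-pos 0<ε (positive⁻¹ B⁻¹ {{1/pos⇒pos (Bx + By) {{positive 0<B}}}})
    N₁ = proj₁ (proj₂ (proj₂ (eventuallyBounded x)))
    H₁ = proj₂ (proj₂ (proj₂ (eventuallyBounded x)))
    N₂ = proj₁ (proj₂ (proj₂ (eventuallyBounded y)))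
    H₂ = proj₂ (proj₂ (proj₂ (eventuallyBounded y)))
    N₃ = proj₁ (cauchy x δ 0<δ)
    H₃ = proj₂ (cauchy x δ 0<δ)
    N₄ = proj₁ (cauchy y δ 0<δ)
    H₄ = proj₂ (cauchy y δ 0<δ)
    N : ℕ
    N = (N₁ ℕ.⊔ N₂) ℕ.⊔ (N₃ ℕ.⊔ N₄)
    bound : ∀ m n → N ℕ.≤ m → N ℕ.≤ n → ∣ seq x m * seq y m - seq x n * seq y n ∣ ≤ ε
    bound m n N≤m N≤n =
      let a = seq x m ; b = seq y m ; c = seq x n ; d = seq y n
          m₁₂ = ⊔-≤ˡ {N₁ ℕ.⊔ N₂} N≤m ; m₃₄ = ⊔-≤ʳ {N₁ ℕ.⊔ N₂} N≤m
          n₁₂ = ⊔-≤ˡ {N₁ ℕ.⊔ N₂} N≤n ; n₃₄ = ⊔-≤ʳ {N₁ ℕ.⊔ N₂} N≤n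
      in
      ≤-trans (≤-reflexive (cong ∣_∣
        (solve 4 (λ a b c d → (a :* b) :- (c :* d) := (a :* (b :- d)) :+ (d :* (a :- c)))
          refl a b c d)))
      (≤-trans (∣p+q∣≤∣p∣+∣q∣ (a * (b - d)) (d * (a - c)))
      (≤-trans (≤-reflexive (cong₂ _+_ (∣p*q∣≡∣p∣*∣q∣ a (b - d)) (∣p*q∣≡∣p∣*∣q∣ d (a - c))))
      (≤-trans (+-mono-≤
        (*-mono-≤-nonNeg (0≤∣p∣ a) (<⇒≤ 0<δ)
          (H₁ m (⊔-≤ˡ m₁₂)) (H₄ m n (⊔-≤ʳ {N₃} m₃₄) (⊔-≤ʳ {N₃} n₃₄)))
        (*-mono-≤-nonNeg (0≤∣p∣ d) (<⇒≤ 0<δ)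
          (H₂ n (⊔-≤ʳ {N₁} n₁₂)) (H₃ m n (⊔-≤ˡ m₃₄) (⊔-≤ˡ n₃₄))))
      (≤-reflexive (begin
        Bx * δ + By * δ           ≡⟨ solve 4 (λ s t e i →
                                       s :* (e :* i) :+ t :* (e :* i) := e :* ((s :+ t) :* i))
                                       refl Bx By ε B⁻¹ ⟩
        ε * ((Bx + By) * B⁻¹)     ≡⟨ cong (ε *_) (*-inverseʳ (Bx + By) {{>-nonZero 0<B}}) ⟩
        ε * 1ℚ                    ≡⟨ *-identityʳ ε ⟩
        ε                         ∎)))))
      where open ≡-Reasoning

open ProductLemmas

_*ʳ_ : ℝ → ℝ → ℝ
x *ʳ y = mkℝ (λ n → seq x n * seq y n) (*-cauchy x y)

-- Only finitely many terms of a positive real can vanish; at those the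
-- reciprocal sequence is given the value 0.
recip₀ : ℚ → ℚ
recip₀ p with p ≟ 0ℚ
... | yes _  = 0ℚ
... | no p≢0 = (1/ p) {{≢-nonZero p≢0}}

module ReciprocalLemmas where

  recip₀-* : ∀ {p} → 0ℚ < p → p * recip₀ p ≡ 1ℚ
  recip₀-* {p} 0<p with p ≟ 0ℚ
  ... | yes p≡0 = contradiction 0<p (<-irrefl (sym p≡0))
  ... | no p≢0  = *-inverseʳ p {{≢-nonZero p≢0}}

  recip₀-nonNeg : ∀ {p} → 0ℚ < p → 0ℚ ≤ recip₀ p
  recip₀-nonNeg {p} 0<p with p ≟ 0ℚ
  ... | yes _ = ≤-refl
  ... | no p≢0 = <⇒≤ (positive⁻¹ _ {{1/pos⇒pos p {{positive 0<p}}}})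

  recip₀-cauchy : ∀ x → 0ʳ <ʳ x → IsCauchy (λ n → recip₀ (seq x n))
  recip₀-cauchy x (e , 0<e , N₁ , H₁) = oneSided λ ε 0<ε →
    let 0<δ = *-pos 0<ε (*-pos 0<e 0<e)
        N₂ , H₂ = cauchy x (ε * (e * e)) 0<δ
    in N₁ ℕ.⊔ N₂ , λ m n N≤m N≤n →
      step ε 0<ε (e≤ m (⊔-≤ˡ N≤m)) (e≤ n (⊔-≤ˡ N≤n))
        (∣p-q∣≤⇒≤ (H₂ n m (⊔-≤ʳ {N₁} N≤n) (⊔-≤ʳ {N₁} N≤m)))
    where
    e≤ : ∀ n → N₁ ℕ.≤ n → e ≤ seq x n
    e≤ n N≤n = ≤-trans (≤-reflexive (sym (+-identityˡ e))) (H₁ n N≤n)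
    step : ∀ ε {a b} → 0ℚ < ε → e ≤ a → e ≤ b → b ≤ a + ε * (e * e) →
           recip₀ a ≤ recip₀ b + ε
    step ε {a} {b} 0<ε e≤a e≤b h = begin
      i                              ≡⟨ *-identityʳ i ⟨
      i * 1ℚ                         ≡⟨ cong (i *_) bj ⟨
      i * (b * j)                    ≡⟨ solve 3 (λ b i j → i :* (b :* j) := b :* (i :* j)) refl b i j ⟩
      b * (i * j)                    ≤⟨ *-monoʳ-≤-nonNeg (i * j) {{nonNegative 0≤ij}} b≤ ⟩
      (a + ε * (a * b)) * (i * j)    ≡⟨ solve 5 (λ a b i j e →
                                          (a :+ e :* (a :* b)) :* (i :* j) :=
                                          (a :* i) :* j :+ e :* ((a :* i) :* (b :* j)))
                                          refl a b i j ε ⟩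
      (a * i) * j + ε * ((a * i) * (b * j))  ≡⟨ cong₂ (λ u v → u * j + ε * (u * v)) ai bj ⟩
      1ℚ * j + ε * (1ℚ * 1ℚ)         ≡⟨ cong₂ _+_ (*-identityˡ j) (*-identityʳ ε) ⟩
      j + ε                          ∎
      where
      open ≤-Reasoning
      i = recip₀ a
      j = recip₀ b
      0<a : 0ℚ < a
      0<a = <-≤-trans 0<e e≤a
      0<b : 0ℚ < b
      0<b = <-≤-trans 0<e e≤b
      ai : a * i ≡ 1ℚ
      ai = recip₀-* 0<a
      bj : b * j ≡ 1ℚ
      bj = recip₀-* 0<b
      0≤ij : 0ℚ ≤ i * j
      0≤ij = *-nonNeg (recip₀-nonNeg 0<a) (recip₀-nonNeg 0<b)
      b≤ : b ≤ a + ε * (a * b)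
      b≤ = ≤-trans h (+-monoʳ-≤ a (*-monoˡ-≤-nonNeg ε {{nonNegative (<⇒≤ 0<ε)}}
             (*-mono-≤-nonNeg (<⇒≤ 0<e) (<⇒≤ 0<b) e≤a e≤b)))

open ReciprocalLemmas

_⁻¹[_] : (x : ℝ) → 0ʳ <ʳ x → ℝ
x ⁻¹[ 0<x ] = mkℝ (λ n → recip₀ (seq x n)) (recip₀-cauchy x 0<x)

-- ⌊√n⌋
isqrt : ℕ → ℕ
isqrt zero = 0
isqrt (suc n) with suc (isqrt n) ℕ.* suc (isqrt n) ℕ.≤? suc n
... | yes _ = suc (isqrt n)
... | no  _ = isqrt n

isqrt-lower : ∀ n → isqrt n ℕ.* isqrt n ℕ.≤ n
isqrt-lower zero = ℕ.z≤n
isqrt-lower (suc n) with suc (isqrt n) ℕ.* suc (isqrt n) ℕ.≤? suc n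
... | yes h = h
... | no  _ = ℕ.m≤n⇒m≤1+n (isqrt-lower n)

isqrt-upper : ∀ n → n ℕ.< suc (isqrt n) ℕ.* suc (isqrt n)
isqrt-upper zero = ℕ.s≤s ℕ.z≤n
isqrt-upper (suc n) with suc (isqrt n) ℕ.* suc (isqrt n) ℕ.≤? suc n
... | yes _ = ℕ.≤-<-trans (isqrt-upper n)
                (ℕ.*-mono-< (ℕ.n<1+n (suc (isqrt n))) (ℕ.n<1+n (suc (isqrt n))))
... | no  h = ℕ.≰⇒> h

-- For q = p/d ≥ 0 and k = n+1 this is ⌊√(p·d·k²)⌋/(d·k), which is within
-- 1/(d·k) of √q = √(p·d·k²)/(d·k).
sqrtApprox : ℕ → ℚ → ℚ
sqrtApprox n q =
  + isqrt (ℤ.∣ ↥ q ∣ ℕ.* ↧ₙ q ℕ.* (suc n ℕ.* suc n)) / (↧ₙ q ℕ.* suc n)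

module SqrtLemmas where

  module SqrtApprox (n : ℕ) (q : ℚ) (0≤q : 0ℚ ≤ q) where
    p d k t : ℕ
    p = ℤ.∣ ↥ q ∣
    d = ↧ₙ q
    k = suc n
    t = isqrt (p ℕ.* d ℕ.* (k ℕ.* k))
    s D : ℚ
    s = sqrtApprox n q
    D = fromℕ (d ℕ.* k)

    sD : s * D ≡ fromℕ t
    sD = /-* (+ t) (d ℕ.* k)

    0<D : 0ℚ < D
    0<D = positive⁻¹ D

    0<DD : 0ℚ < D * D
    0<DD = *-pos 0<D 0<D

    qd : q * fromℕ d ≡ fromℕ p
    qd = trans (↥-↧ q) (cong fromℤ (sym (ℤ.0≤i⇒+∣i∣≡i (0≤↥ q 0≤q))))
      where
      0≤↥ : ∀ q → 0ℚ ≤ q → + 0 ℤ.≤ ↥ q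
      0≤↥ q@(mkℚ i d _) (*≤* h) = subst (+ 0 ℤ.≤_) (ℤ.*-identityʳ i) h

    qDD : q * (D * D) ≡ fromℕ (p ℕ.* d ℕ.* (k ℕ.* k))
    qDD = begin
      q * (D * D)                                           ≡⟨ cong (λ D → q * (D * D)) (fromℕ-* d k) ⟩
      q * ((fromℕ d * fromℕ k) * (fromℕ d * fromℕ k))       ≡⟨ solve 3 (λ q d k →
                                                                 q :* ((d :* k) :* (d :* k)) :=
                                                                 ((q :* d) :* d) :* (k :* k))
                                                                 refl q (fromℕ d) (fromℕ k) ⟩
      q * fromℕ d * fromℕ d * (fromℕ k * fromℕ k)           ≡⟨ cong (λ u → u * fromℕ d * (fromℕ k * fromℕ k)) qd ⟩
      fromℕ p * fromℕ d * (fromℕ k * fromℕ k)               ≡⟨ cong₂ _*_ (fromℕ-* p d) (fromℕ-* k k) ⟨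
      fromℕ (p ℕ.* d) * fromℕ (k ℕ.* k)                     ≡⟨ fromℕ-* (p ℕ.* d) (k ℕ.* k) ⟨
      fromℕ (p ℕ.* d ℕ.* (k ℕ.* k))                         ∎
      where open ≡-Reasoning

    square : ∀ a b → (a * b) * (a * b) ≡ (a * a) * (b * b)
    square = solve 2 (λ a b → (a :* b) :* (a :* b) := (a :* a) :* (b :* b)) refl

    0≤s : 0ℚ ≤ s
    0≤s = *-cancelʳ-≤-pos D {{positive 0<D}}
      (≤-trans (≤-reflexive (*-zeroˡ D))
        (≤-trans (fromℕ-mono {0} {t} ℕ.z≤n) (≤-reflexive (sym sD))))

    lower : s * s ≤ q
    lower = *-cancelʳ-≤-pos (D * D) {{positive 0<DD}} (begin
      s * s * (D * D)                 ≡⟨ square s D ⟨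
      (s * D) * (s * D)               ≡⟨ cong₂ _*_ sD sD ⟩
      fromℕ t * fromℕ t               ≡⟨ fromℕ-* t t ⟨
      fromℕ (t ℕ.* t)                 ≤⟨ fromℕ-mono (isqrt-lower _) ⟩
      fromℕ (p ℕ.* d ℕ.* (k ℕ.* k))   ≡⟨ qDD ⟨
      q * (D * D)                     ∎)
      where open ≤-Reasoning

    upper : q ≤ (s + recip n) * (s + recip n)
    upper = *-cancelʳ-≤-pos (D * D) {{positive 0<DD}} (begin
      q * (D * D)                              ≡⟨ qDD ⟩
      fromℕ (p ℕ.* d ℕ.* (k ℕ.* k))            ≤⟨ fromℕ-mono (ℕ.<⇒≤ (isqrt-upper _)) ⟩
      fromℕ (suc t ℕ.* suc t)                  ≤⟨ fromℕ-mono (ℕ.*-mono-≤ t+1≤ t+1≤) ⟩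
      fromℕ ((t ℕ.+ d) ℕ.* (t ℕ.+ d))          ≡⟨ fromℕ-* (t ℕ.+ d) (t ℕ.+ d) ⟩
      fromℕ (t ℕ.+ d) * fromℕ (t ℕ.+ d)        ≡⟨ cong₂ _*_ eq eq ⟩
      ((s + recip n) * D) * ((s + recip n) * D)  ≡⟨ square (s + recip n) D ⟩
      (s + recip n) * (s + recip n) * (D * D)  ∎)
      where
      open ≤-Reasoning
      t+1≤ : suc t ℕ.≤ t ℕ.+ d
      t+1≤ = ℕ.≤-trans (ℕ.≤-reflexive (ℕ.+-comm 1 t)) (ℕ.+-monoʳ-≤ t (ℕ.s≤s ℕ.z≤n))
      recipD : recip n * D ≡ fromℕ d
      recipD = trans (cong (recip n *_) (fromℕ-* d k))
        (trans (solve 3 (λ r d k → r :* (d :* k) := d :* (r :* k)) refl (recip n) (fromℕ d) (fromℕ k))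
        (trans (cong (fromℕ d *_) (recip-* n)) (*-identityʳ (fromℕ d))))
      eq : fromℕ (t ℕ.+ d) ≡ (s + recip n) * D
      eq = trans (fromℕ-+ t d) (sym (trans (*-distribʳ-+ D s (recip n)) (cong₂ _+_ sD recipD)))

  sqrt-step : ∀ m n δ {p q} → 0ℚ < δ → 0ℚ ≤ p → 0ℚ ≤ q → p ≤ q + δ * δ →
              sqrtApprox m p ≤ (sqrtApprox n q + recip n) + δ
  sqrt-step m n δ {p} {q} 0<δ 0≤p 0≤q h = square-cancel-≤ (+-nonNeg 0≤u (<⇒≤ 0<δ)) (begin
    sqrtApprox m p * sqrtApprox m p   ≤⟨ SqrtApprox.lower m p 0≤p ⟩
    p                                 ≤⟨ h ⟩
    q + δ * δ                         ≤⟨ +-monoˡ-≤ (δ * δ) (SqrtApprox.upper n q 0≤q) ⟩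
    u * u + δ * δ                     ≤⟨ p≤p+q (+-nonNeg 0≤uδ 0≤uδ) ⟩
    (u * u + δ * δ) + (u * δ + u * δ) ≡⟨ solve 2 (λ u e →
                                           (u :* u :+ e :* e) :+ (u :* e :+ u :* e) :=
                                           (u :+ e) :* (u :+ e)) refl u δ ⟩
    (u + δ) * (u + δ)                 ∎)
    where
    open ≤-Reasoning
    u = sqrtApprox n q + recip n
    0≤u : 0ℚ ≤ u
    0≤u = +-nonNeg (SqrtApprox.0≤s n q 0≤q) (<⇒≤ (recip-pos n))
    0≤uδ : 0ℚ ≤ u * δ
    0≤uδ = *-nonNeg 0≤u (<⇒≤ 0<δ)

  sqrt-cauchy : ∀ x → IsCauchy (λ n → sqrtApprox n (seq x n ⊔ 0ℚ))
  sqrt-cauchy x = oneSided λ ε 0<ε →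
    let δ = ε * ½
        0<δ = ½-pos 0<ε
        N₁ , H₁ = cauchy x (δ * δ) (*-pos 0<δ 0<δ)
        N₂ , H₂ = archimedean δ 0<δ
    in N₁ ℕ.⊔ N₂ , λ m n N≤m N≤n →
      let a = seq x m ; b = seq x n ; s = sqrtApprox n (b ⊔ 0ℚ) in
      ≤-trans (sqrt-step m n δ 0<δ (p≤q⊔p a 0ℚ) (p≤q⊔p b 0ℚ)
        (⊔-lub
          (≤-trans (∣p-q∣≤⇒≤ {a} {b} (H₁ m n (⊔-≤ˡ N≤m) (⊔-≤ˡ N≤n))) (+-monoˡ-≤ (δ * δ) (p≤p⊔q b 0ℚ)))
          (+-nonNeg (p≤q⊔p b 0ℚ) (<⇒≤ (*-pos 0<δ 0<δ)))))
      (≤-trans (≤-reflexive (+-assoc s (recip n) δ))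
      (+-monoʳ-≤ s (≤-trans (+-monoˡ-≤ δ (H₂ n (⊔-≤ʳ {N₁} N≤n))) (≤-reflexive (halves ε)))))

open SqrtLemmas

-- √ x is the square root of max(x, 0).
√ : ℝ → ℝ
√ x = mkℝ (λ n → sqrtApprox n (seq x n ⊔ 0ℚ)) (sqrt-cauchy x)

∑ : (ℕ → ℚ) → ℕ → ℚ
∑ f zero    = 0ℚ
∑ f (suc n) = ∑ f n + f n

-- The right Riemann sum of ∫₁ᵐ dt/t with mesh 1/k:
-- the sum over 1 ≤ i ≤ (m-1)k of (1/k) · 1/(1 + i/k) = 1/(k + i).
logSum : ℕ → ℕ → ℚ
logSum m k = ∑ (λ i → recip (k ℕ.+ i)) ((m ℕ.∸ 1) ℕ.* k)

module LogLemmas where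

  ∑-mono : ∀ {f g} n → (∀ i → i ℕ.< n → f i ≤ g i) → ∑ f n ≤ ∑ g n
  ∑-mono zero    h = ≤-refl
  ∑-mono (suc n) h = +-mono-≤ (∑-mono n (λ i i<n → h i (ℕ.m<n⇒m<1+n i<n))) (h n (ℕ.n<1+n n))

  ∑-split : ∀ f m n → ∑ f (m ℕ.+ n) ≡ ∑ f m + ∑ (λ i → f (m ℕ.+ i)) n
  ∑-split f m zero    = trans (cong (∑ f) (ℕ.+-identityʳ m)) (sym (+-identityʳ _))
  ∑-split f m (suc n) = trans (cong (∑ f) (ℕ.+-suc m n))
    (trans (cong (_+ f (m ℕ.+ n)) (∑-split f m n)) (+-assoc (∑ f m) (∑ (λ i → f (m ℕ.+ i)) n) (f (m ℕ.+ n))))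

  ∑-blocks : ∀ f n j → ∑ f (n ℕ.* j) ≡ ∑ (λ a → ∑ (λ b → f (a ℕ.* j ℕ.+ b)) j) n
  ∑-blocks f zero    j = refl
  ∑-blocks f (suc n) j = trans (cong (∑ f) (ℕ.+-comm j (n ℕ.* j)))
    (trans (∑-split f (n ℕ.* j) j) (cong (_+ ∑ (λ b → f (n ℕ.* j ℕ.+ b)) j) (∑-blocks f n j)))

  ∑-const : ∀ c n → ∑ (λ _ → c) n ≡ c * fromℕ n
  ∑-const c zero    = sym (*-zeroʳ c)
  ∑-const c (suc n) = trans (cong (_+ c) (∑-const c n))
    (trans (cong (λ u → c * fromℕ n + u) (sym (*-identityʳ c)))
    (trans (sym (*-distribˡ-+ c (fromℕ n) (fromℕ 1)))
    (cong (c *_) (trans (sym (fromℕ-+ n 1)) (cong fromℕ (ℕ.+-comm n 1))))))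

  recip-block : ∀ c j → ∑ (λ _ → recip (j ℕ.+ c ℕ.* suc j)) (suc j) ≡ recip c
  recip-block c j = trans (∑-const r (suc j)) (begin
    r * J              ≡⟨ *-identityʳ (r * J) ⟨
    r * J * 1ℚ         ≡⟨ cong (r * J *_) (recip-* c) ⟨
    r * J * (s * C)    ≡⟨ solve 4 (λ r J s C → (r :* J) :* (s :* C) := s :* (r :* (C :* J)))
                            refl r J s C ⟩
    s * (r * (C * J))  ≡⟨ cong (λ u → s * (r * u)) (fromℕ-* (suc c) (suc j)) ⟨
    s * (r * fromℕ (suc (j ℕ.+ c ℕ.* suc j)))  ≡⟨ cong (s *_) (recip-* (j ℕ.+ c ℕ.* suc j)) ⟩
    s * 1ℚ             ≡⟨ *-identityʳ s ⟩
    s                  ∎)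
    where
    open ≡-Reasoning
    r = recip (j ℕ.+ c ℕ.* suc j)
    s = recip c
    J = fromℕ (suc j)
    C = fromℕ (suc c)

  -- the left Riemann sum with mesh 1/(k+1)
  upperSum : ℕ → ℕ → ℚ
  upperSum m k = ∑ (λ i → recip (k ℕ.+ i)) ((m ℕ.∸ 1) ℕ.* suc k)

  ∑-shift : ∀ k n → ∑ (λ i → recip (k ℕ.+ i)) n ≤ ∑ (λ i → recip (suc k ℕ.+ i)) n + recip k
  ∑-shift k n = ≤-trans (p≤p+q (<⇒≤ (recip-pos (k ℕ.+ n)))) (≤-reflexive (begin
    ∑ f n + f n                             ≡⟨⟩
    ∑ f (1 ℕ.+ n)                           ≡⟨ ∑-split f 1 n ⟩
    0ℚ + f 0 + ∑ (λ i → f (1 ℕ.+ i)) n      ≡⟨ cong (_+ ∑ (λ i → f (1 ℕ.+ i)) n) (+-identityˡ (f 0)) ⟩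
    f 0 + ∑ (λ i → f (1 ℕ.+ i)) n           ≡⟨ +-comm (f 0) (∑ (λ i → f (1 ℕ.+ i)) n) ⟩
    ∑ (λ i → f (1 ℕ.+ i)) n + f 0           ≡⟨ cong₂ _+_ (∑-cong n (λ i → cong recip (ℕ.+-suc k i)))
                                                (cong recip (ℕ.+-identityʳ k)) ⟩
    ∑ (λ i → recip (suc k ℕ.+ i)) n + recip k  ∎))
    where
    open ≡-Reasoning
    f : ℕ → ℚ
    f i = recip (k ℕ.+ i)
    ∑-cong : ∀ {f g : ℕ → ℚ} n → (∀ i → f i ≡ g i) → ∑ f n ≡ ∑ g n
    ∑-cong zero    h = refl
    ∑-cong (suc n) h = cong₂ _+_ (∑-cong n h) (h n)

  open import Data.Nat.Solver using () renaming (module +-*-Solver to ℕ-Solver)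

  -- both sums are compared with the right Riemann sum of mesh 1/((j+1)(k+1))
  logSum≤upperSum : ∀ m k j → logSum m (suc k) ≤ upperSum m j
  logSum≤upperSum m k j = begin
    ∑ (λ a → recip (suc k ℕ.+ a)) (M ℕ.* suc k)
      ≤⟨ ∑-mono (M ℕ.* suc k) (λ a _ → ≤-trans (≤-reflexive (sym (recip-block (suc k ℕ.+ a) j)))
           (∑-mono (suc j) (λ b b<j → recip-anti (fine≥ a b (ℕ.≤-pred b<j))))) ⟩
    ∑ (λ a → ∑ (λ b → f (a ℕ.* suc j ℕ.+ b)) (suc j)) (M ℕ.* suc k)
      ≡⟨ ∑-blocks f (M ℕ.* suc k) (suc j) ⟨
    ∑ f (M ℕ.* suc k ℕ.* suc j)
      ≡⟨ cong (∑ f) (solveℕ 3 (λ M K J → M :*ℕ K :*ℕ J :=ℕ M :*ℕ J :*ℕ K) refl M (suc k) (suc j)) ⟩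
    ∑ f (M ℕ.* suc j ℕ.* suc k)
      ≡⟨ ∑-blocks f (M ℕ.* suc j) (suc k) ⟩
    ∑ (λ a → ∑ (λ b → f (a ℕ.* suc k ℕ.+ b)) (suc k)) (M ℕ.* suc j)
      ≤⟨ ∑-mono (M ℕ.* suc j) (λ a _ → ≤-trans
           (∑-mono (suc k) (λ b _ → recip-anti (fine≤ a b)))
           (≤-reflexive (recip-block (j ℕ.+ a) k))) ⟩
    ∑ (λ a → recip (j ℕ.+ a)) (M ℕ.* suc j)  ∎
    where
    open ≤-Reasoning
    open ℕ-Solver using () renaming (solve to solveℕ; _:*_ to _:*ℕ_; _:+_ to _:+ℕ_; _:=_ to _:=ℕ_; con to conℕ)
    M = m ℕ.∸ 1
    f : ℕ → ℚ
    f i = recip (suc k ℕ.* suc j ℕ.+ i)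
    fine≥ : ∀ a b → b ℕ.≤ j →
      suc k ℕ.* suc j ℕ.+ (a ℕ.* suc j ℕ.+ b) ℕ.≤ j ℕ.+ (suc k ℕ.+ a) ℕ.* suc j
    fine≥ a b b≤j = ℕ.≤-trans
      (ℕ.≤-reflexive (solveℕ 4 (λ K J a b →
        K :*ℕ J :+ℕ (a :*ℕ J :+ℕ b) :=ℕ b :+ℕ (K :+ℕ a) :*ℕ J) refl (suc k) (suc j) a b))
      (ℕ.+-monoˡ-≤ ((suc k ℕ.+ a) ℕ.* suc j) b≤j)
    fine≤ : ∀ a b →
      k ℕ.+ (j ℕ.+ a) ℕ.* suc k ℕ.≤ suc k ℕ.* suc j ℕ.+ (a ℕ.* suc k ℕ.+ b)
    fine≤ a b = ℕ.≤-trans (ℕ.m≤m+n _ (1 ℕ.+ b))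
      (ℕ.≤-reflexive (solveℕ 4 (λ k j a b →
        (k :+ℕ (j :+ℕ a) :*ℕ (conℕ 1 :+ℕ k)) :+ℕ (conℕ 1 :+ℕ b) :=ℕ
        (conℕ 1 :+ℕ k) :*ℕ (conℕ 1 :+ℕ j) :+ℕ (a :*ℕ (conℕ 1 :+ℕ k) :+ℕ b)) refl k j a b))

  log-cauchy : ∀ m → IsCauchy (λ n → logSum m (suc n))
  log-cauchy m = oneSided λ ε 0<ε →
    let N , H = archimedean ε 0<ε in
    N , λ k j _ N≤j →
      ≤-trans (logSum≤upperSum m k j)
      (≤-trans (∑-shift j ((m ℕ.∸ 1) ℕ.* suc j))
      (+-monoʳ-≤ (logSum m (suc j)) (H j N≤j)))

open LogLemmas

log : (m : ℕ) → .{{ℕ.NonZero m}} → ℝ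
log m = mkℝ (λ n → logSum m (suc n)) (log-cauchy m)

φ : ℕ → ℕ
φ m = length (filter (λ k → coprime? k m) (applyUpTo suc m))

φ-nonZero : ∀ m → .{{ℕ.NonZero m}} → ℕ.NonZero (φ m)
φ-nonZero m@(suc n) = subst (λ ks → ℕ.NonZero (length ks))
  (sym (filter-accept (λ k → coprime? k m) {xs = applyUpTo (λ k → suc (suc k)) n} (1-coprimeTo m))) _

m/φ[m] : (m : ℕ) → .{{ℕ.NonZero m}} → ℚ
m/φ[m] m = (+ m / φ m) {{φ-nonZero m}}

-- The residue class r mod m is represented by its least nonnegative element.
Products : (m : ℕ) → .{{ℕ.NonZero m}} → ℝ → ℤ → Fin m → Set
Products m Δ S r = ∃₂ λ (q : ℕ) (y : ℤ) →
  (1 ℕ.≤ q × ℕ→ℝ q ≤ʳ √ (ℕ→ℝ m) × Prime q) ×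
  (S ℤ.+ + 1 ℤ.≤ y ×
   ℤ→ℝ y ≤ʳ ℤ→ℝ S +ʳ Δ *ʳ √ (ℕ→ℝ m) *ʳ √ (fromℚ (m/φ[m] m)) *ʳ log m) ×
  (+ q ℤ.* y) %ℕ m ≡ toℕ r

HasSize : ∀ {m} → (Fin m → Set) → ℕ → Set
HasSize {m} P N = ∃ λ (A : Subset m) → (∀ r → r ∈ A ⇔ P r) × card A ≡ N

-- Real inequalities are undecidable, so a size cannot be computed in
-- general; it nevertheless cannot fail to exist.
¬¬-hasSize : ∀ {m} (P : Fin m → Set) → ¬ ¬ ∃ (HasSize P)
¬¬-hasSize {zero} P k = k (0 , [] , (λ ()) , refl)
¬¬-hasSize {suc m} P k = ¬¬-hasSize (λ i → P (suc i)) λ where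
  (N , A , A⇔P , _) →
    let suc⇔ : ∀ {b} i → suc i ∈ (b ∷ A) ⇔ P (suc i)
        suc⇔ i = mk⇔ (λ { (there i∈A) → Equivalence.to (A⇔P i) i∈A })
                     (λ p → there (Equivalence.from (A⇔P i) p))
    in k (_ , outside ∷ A
            , (λ { zero    → mk⇔ (λ ()) (λ p → contradiction
                     (_ , inside ∷ A
                        , (λ { zero    → mk⇔ (λ _ → p) (λ _ → here)
                             ; (suc i) → suc⇔ i })
                        , refl) k)
                 ; (suc i) → suc⇔ i })
            , refl)

TendsToInfinity : ((m : ℕ) → .{{ℕ.NonZero m}} → ℝ) → Set
TendsToInfinity f = ∀ (K : ℝ) → ∃ λ M → ∀ m → .{{_ : ℕ.NonZero m}} → M ℕ.≤ m → K ≤ʳ f m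

-- Second moment method. Let X = ⌊√m⌋, let H be about Δ √m log m, and let P be a set of Q primes
-- q ≤ X, q ∤ m, all at least Q, with Q of order X / log m; such primes exist by Chebyshev's lower
-- bound, as at most 2 log₂ X + 2 primes divide m. For q ≠ q′ in P the congruence
-- q y ≡ q′ y′ (mod m) has at most H²/m + O(H/Q) solutions in an interval of H integers, so the QH
-- products q y coincide modulo m in at most (QH)²/m + O(QH) pairs. By the Cauchy–Schwarz
-- inequality they miss at most O(m²/(QH)) = O(m/Δ) residue classes.
module Submission where

open import Defs

-- The off-diagonal count must have leading coefficient exactly 1. With W = Q H and N the number of
-- classes hit, Cauchy-Schwarz then reads m W² ≤ N (W² + O(m W)), and the quadratic terms combine
-- into (m - N) W² ≤ O(m² W). A bound c H²/m with c > 1 would only give a positive proportion of the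
-- classes. The exact coefficient comes from an injective encoding of the solutions into an explicit
-- range; its rounding cost 1 + H/q′ per pair stays harmless because q′ ≥ Q.
--
-- The diagonal count needs H ≤ m. If the interval contains a full period, a single prime q not
-- dividing m already reaches every class.
--
-- All counting takes place in ℕ with integer substitutes: X = ⌊√m⌋, a natural number D with D ≤ Δ ≤
-- 4 D, l = ⌊log₂ X⌋ for log m, and H = D X l. The lower comparisons (D ≤ Δ, l ≤ log m, 1 ≤ m/φ(m))
-- place the counted products inside the given set. The upper comparisons m ≤ 4 X², X ≤ 32 Q l and Δ
-- ≤ 4 D turn O(m²/(Q H)) missed classes into O(m/Δ). Since N ≤ m, the relative error is minus the
-- proportion missed.

module CoveringBound where

  open import Defs using (isqrt; isqrt-lower; isqrt-upper)
  open import Data.Nat.Base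
  open import Data.Nat.Properties
  open import Data.Nat.DivMod
  open import Data.Nat.Divisibility
  open import Data.Nat.Primality
  open import Data.Nat.Primality.Factorisation using (factorise)
  open import Data.Nat.Coprimality using (Coprime; coprime-divisor)
  open import Data.Nat.Combinatorics using (_C_; nCk+nC[k+1]≡[n+1]C[k+1]; nC1≡n; nCn≡1)
  open import Data.Nat.Induction using (<-wellFounded; Acc; acc)
  open import Data.Nat.ListAction using (sum; product)
  open import Data.Nat.ListAction.Properties using (sum-++)
  open import Data.Nat.Tactic.RingSolver using (solve-∀)
  open import Data.Fin.Base using (Fin; zero; suc; fromℕ<)
  import Data.Fin.Properties as Fin
  open import Data.Fin.Subset using (Subset; inside; outside) renaming (_∈_ to _∈ˢ_; ∣_∣ to card)
  open import Data.Fin.Subset.Properties using (∣p∣≤n)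
  open import Data.Vec.Base using ([]; _∷_; here; there)
  open import Data.List.Base using (List; []; _∷_; length; filter; upTo; map; _++_; take; cartesianProduct; lookup)
  open import Data.List.Properties using (map-++; map-∘; length-++; length-map; length-upTo; length-take)
  open import Data.List.Membership.Propositional using (_∈_)
  open import Data.List.Membership.Propositional.Properties
    using (∈-lookup; ∈-filter⁺; ∈-upTo⁺; ∈-upTo⁻; ∈-cartesianProduct⁻)
  open import Data.List.Relation.Unary.All as All using (All; []; _∷_)
  open import Data.List.Relation.Unary.All.Properties using (all-filter)
    renaming (filter⁺ to all-filter⁺; take⁺ to all-take⁺)
  open import Data.List.Relation.Unary.Any using (here; there)
  open import Data.List.Relation.Unary.Unique.Propositional using (Unique; []; _∷_)
  open import Data.List.Relation.Unary.Unique.Propositional.Properties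
    using (filter⁺; upTo⁺; take⁺; cartesianProduct⁺)
  open import Data.Product.Base using (∃; ∃₂; _×_; _,_; proj₁; proj₂)
  open import Data.Sum.Base using (inj₁; inj₂; [_,_]′)
  open import Function.Base using (_∘_; id)
  open import Relation.Nullary using (Dec; yes; no; ¬?; contradiction)
  open import Relation.Unary using (Pred; Decidable)
  open import Relation.Binary.PropositionalEquality hiding (J)

  -- Chebyshev's lower bound for the number of primes

  ^-bracket : ∀ b n → 2 ≤ b → 1 ≤ n → ∃ λ e → b ^ e ≤ n × n < b ^ suc e
  ^-bracket b (suc zero) 2≤b _ = 0 , ≤-refl , ≤-trans 2≤b (≤-reflexive (sym (*-identityʳ b)))
  ^-bracket b (suc n@(suc _)) 2≤b _ with ^-bracket b n 2≤b (s≤s z≤n)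
  ... | e , bᵉ≤n , n<bᵉ⁺¹ with suc n <? b ^ suc e
  ...   | yes 1+n<bᵉ⁺¹ = e , m≤n⇒m≤1+n bᵉ≤n , 1+n<bᵉ⁺¹
  ...   | no  1+n≮bᵉ⁺¹ = suc e , ≮⇒≥ 1+n≮bᵉ⁺¹ , (begin-strict
    suc n               ≤⟨ n<bᵉ⁺¹ ⟩
    b ^ suc e           <⟨ m<m*n (b ^ suc e) b {{>-nonZero (<-≤-trans (s≤s z≤n) n<bᵉ⁺¹)}} 2≤b ⟩
    b ^ suc e * b       ≡⟨ *-comm (b ^ suc e) b ⟩
    b ^ suc (suc e)     ∎)
    where open ≤-Reasoning

  absorption : ∀ n k → suc k * (suc n C suc k) ≡ suc n * (n C k)
  absorption zero zero = refl
  absorption zero (suc k) = *-zeroʳ (suc (suc k))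
  absorption (suc n) zero = trans (+-identityʳ _) (trans (nC1≡n (suc (suc n))) (sym (*-identityʳ (suc (suc n)))))
  absorption (suc n) (suc k) = begin
    suc (suc k) * (suc (suc n) C suc (suc k))
      ≡⟨ cong (suc (suc k) *_) (nCk+nC[k+1]≡[n+1]C[k+1] (suc n) (suc k)) ⟨
    suc (suc k) * (a + b)
      ≡⟨ split k a b ⟩
    suc k * a + suc (suc k) * b + a
      ≡⟨ cong₂ (λ u v → u + v + a) (absorption n k) (absorption n (suc k)) ⟩
    suc n * (n C k) + suc n * (n C suc k) + a
      ≡⟨ cong (_+ a) (*-distribˡ-+ (suc n) (n C k) (n C suc k)) ⟨
    suc n * (n C k + n C suc k) + a
      ≡⟨ cong (λ u → suc n * u + a) (nCk+nC[k+1]≡[n+1]C[k+1] n k) ⟩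
    suc n * a + a
      ≡⟨ +-comm (suc n * a) a ⟩
    suc (suc n) * a ∎
    where
    open ≡-Reasoning
    a = suc n C suc k
    b = suc n C suc (suc k)
    split : ∀ k a b → suc (suc k) * (a + b) ≡ suc k * a + suc (suc k) * b + a
    split = solve-∀

  -- By Pascal's rule `C(2k+2, k+1)` is `C(2k+1, k) + C(2k+1, k+1)`, and each summand is at least
  -- `C(2k, k)`.
  2^k≤2kCk : ∀ k → 2 ^ k ≤ (k + k) C k
  2^k≤2kCk zero = ≤-refl
  2^k≤2kCk (suc k) = begin
    2 * 2 ^ k ≤⟨ *-monoʳ-≤ 2 (2^k≤2kCk k) ⟩
    2 * c ≡⟨ cong (c +_) (+-identityʳ c) ⟩
    c + c ≤⟨ +-mono-≤ (lower k) (≤-trans (m≤m+n c _) (≤-reflexive (nCk+nC[k+1]≡[n+1]C[k+1] (k + k) k))) ⟩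
    suc (k + k) C k + suc (k + k) C suc k ≡⟨ nCk+nC[k+1]≡[n+1]C[k+1] (suc (k + k)) k ⟩
    suc (suc (k + k)) C suc k ≡⟨ cong (_C suc k) (cong suc (+-suc k k)) ⟨
    (suc k + suc k) C suc k ∎
    where
    open ≤-Reasoning
    c = (k + k) C k
    lower : ∀ k → (k + k) C k ≤ suc (k + k) C k
    lower zero = ≤-refl
    lower (suc k) = ≤-trans (m≤n+m _ ((suc k + suc k) C k))
      (≤-reflexive (nCk+nC[k+1]≡[n+1]C[k+1] (suc k + suc k) k))

  -- Leibniz's harmonic triangle: 1/((n+1)C(n,k)) is a difference of two such
  -- numbers with smaller k, so d/((n+1)C(n,k)) is an integer by induction on k.
  leibniz-∣ : ∀ d N → (∀ i → 1 ≤ i → i ≤ N → i ∣ d) →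
              ∀ k n → suc n ≤ N → k ≤ n → suc n * (n C k) ∣ d
  leibniz-∣ d N h zero n n<N _ = subst (_∣ d) (sym (*-identityʳ (suc n))) (h (suc n) (s≤s z≤n) n<N)
  leibniz-∣ d N h (suc k) (suc n) n<N (s≤s k≤n) with k ≟ n
  ... | yes refl = subst (_∣ d) (sym (trans (cong (suc (suc n) *_) (nCn≡1 (suc n))) (*-identityʳ (suc (suc n)))))
          (h (suc (suc n)) (s≤s z≤n) n<N)
  ... | no k≢n with leibniz-∣ d N h k n (<⇒≤ n<N) k≤n
                  | leibniz-∣ d N h k (suc n) n<N (m≤n⇒m≤1+n k≤n)
  ...   | divides s d≡sa | divides t d≡tb =
    ∣m+n∣m⇒∣n (subst (c ∣_) cs≡ct+d (m∣m*n s)) (m∣m*n t)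
    where
    open ≡-Reasoning
    K = suc k
    M = suc (suc n)
    u = suc n C suc k
    v = suc n C k
    c = M * u
    us≡ : s * u ≡ t * (v + u)
    us≡ = *-cancelˡ-≡ (s * u) (t * (v + u)) K (begin
      K * (s * u) ≡⟨ swap K s u ⟩
      s * (K * u) ≡⟨ cong (s *_) (absorption n k) ⟩
      s * (suc n * (n C k)) ≡⟨ trans (sym d≡sa) d≡tb ⟩
      t * (M * v) ≡⟨ cong (t *_) (absorption (suc n) k) ⟨
      t * (K * (M C K)) ≡⟨ cong (λ w → t * (K * w)) (nCk+nC[k+1]≡[n+1]C[k+1] (suc n) k) ⟨
      t * (K * (v + u)) ≡⟨ swap t K (v + u) ⟩
      K * (t * (v + u)) ∎)
      where
      swap : ∀ a b c → a * (b * c) ≡ b * (a * c)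
      swap = solve-∀
    -- The triangle rule 1/c = 1/a - 1/b, with a = (n+1) C(n,k) and b = (n+2) C(n+1,k), says d/c = s
    -- - t after multiplication by `d`.
    cs≡ct+d : c * s ≡ c * t + d
    cs≡ct+d = begin
      M * u * s ≡⟨ comm M u s ⟩
      M * (s * u) ≡⟨ cong (M *_) us≡ ⟩
      M * (t * (v + u)) ≡⟨ distr M t u v ⟩
      M * u * t + t * (M * v) ≡⟨ cong (M * u * t +_) d≡tb ⟨
      M * u * t + d ∎
      where
      comm : ∀ M u s → M * u * s ≡ M * (s * u)
      comm = solve-∀
      distr : ∀ M t u v → M * (t * (v + u)) ≡ M * u * t + t * (M * v)
      distr = solve-∀

  extractPower : ∀ p k → 2 ≤ p → 1 ≤ k → ∃₂ λ a k′ → k ≡ p ^ a * k′ × p ∤ k′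
  extractPower p k 2≤p 1≤k = go k 1≤k (<-wellFounded k)
    where
    go : ∀ k → 1 ≤ k → Acc _<_ k → ∃₂ λ a k′ → k ≡ p ^ a * k′ × p ∤ k′
    go k 1≤k (acc rs) with p ∣? k
    ... | no p∤k = 0 , k , sym (*-identityˡ k) , p∤k
    ... | yes p∣k@(divides j@(suc _) refl) with go j (s≤s z≤n) (rs (m<m*n j p 2≤p))
    ...   | a , k′ , j≡ , p∤k′ = suc a , k′
          , trans (cong (_* p) j≡) (comm (p ^ a) k′ p) , p∤k′
          where
          comm : ∀ x y z → x * y * z ≡ z * x * y
          comm = solve-∀

  -- W is the product over the listed primes p of the largest power of p below n.
  commonMultiple : ∀ n ps → 1 ≤ n → All Prime ps → ∃ λ W → W ≤ n ^ length ps × 1 ≤ W ×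
    (∀ k → 1 ≤ k → k ≤ n → (∀ p → Prime p → p ∣ k → p ∈ ps) → k ∣ W)
  commonMultiple n [] 1≤n [] = 1 , ≤-refl , ≤-refl , λ k 1≤k _ h → one k 1≤k h
    where
    one : ∀ k → 1 ≤ k → (∀ p → Prime p → p ∣ k → p ∈ []) → k ∣ 1
    one k 1≤k h with factorise k {{>-nonZero 1≤k}}
    ... | record { factors = [] ; isFactorisation = eq } = ∣-reflexive eq
    ... | record { factors = p ∷ ps ; isFactorisation = refl ; factorsPrime = p-prime ∷ _ }
      with () ← h p p-prime (m∣m*n _)
  commonMultiple n (p ∷ ps) 1≤n (p-prime ∷ primes) with commonMultiple n ps 1≤n primes
  ... | W , W≤ , 1≤W , W-multiple = p ^ e * W , *-mono-≤ pᵉ≤n W≤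
      , *-mono-≤ (m^n>0 p {{prime⇒nonZero p-prime}} e) 1≤W , multiple
    where
    2≤p : 2 ≤ p
    2≤p = nonTrivial⇒n>1 p {{prime⇒nonTrivial p-prime}}
    e = proj₁ (^-bracket p n 2≤p 1≤n)
    pᵉ≤n = proj₁ (proj₂ (^-bracket p n 2≤p 1≤n))
    n<pᵉ⁺¹ = proj₂ (proj₂ (^-bracket p n 2≤p 1≤n))
    multiple : ∀ k → 1 ≤ k → k ≤ n → (∀ q → Prime q → q ∣ k → q ∈ p ∷ ps) → k ∣ p ^ e * W
    multiple k 1≤k k≤n h with extractPower p k 2≤p 1≤k
    -- `p ^ a ≤ k ≤ n` forces `a ≤ e`; the cofactor `k′` has lost `p`, so its primes lie in `ps`.
    ... | a , k′ , refl , p∤k′ = *-pres-∣ pᵃ∣pᵉ (W-multiple k′ 1≤k′ k′≤n h′)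
      where
      1≤k′ : 1 ≤ k′
      1≤k′ = n≢0⇒n>0 λ k′≡0 → p∤k′ (subst (p ∣_) (sym k′≡0) (p ∣0))
      k′≤n : k′ ≤ n
      k′≤n = ≤-trans (m≤n*m k′ (p ^ a) {{m^n≢0 p a {{prime⇒nonZero p-prime}}}}) k≤n
      pᵃ≤n : p ^ a ≤ n
      pᵃ≤n = ≤-trans (m≤m*n (p ^ a) k′ {{>-nonZero 1≤k′}}) k≤n
      a≤e : a ≤ e
      a≤e = ≮⇒≥ λ e<a → <⇒≱ n<pᵉ⁺¹ (≤-trans (^-monoʳ-≤ p {{prime⇒nonZero p-prime}} e<a) pᵃ≤n)
      pᵃ∣pᵉ : p ^ a ∣ p ^ e
      pᵃ∣pᵉ = divides (p ^ (e ∸ a)) (trans (cong (p ^_) (sym (m∸n+n≡m a≤e)))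
        (^-distribˡ-+-* p (e ∸ a) a))
      h′ : ∀ q → Prime q → q ∣ k′ → q ∈ ps
      h′ q q-prime q∣k′ with h q q-prime (∣n⇒∣m*n (p ^ a) q∣k′)
      ... | here refl = contradiction q∣k′ p∤k′
      ... | there q∈ps = q∈ps


  primesUpTo : ℕ → List ℕ
  primesUpTo n = filter prime? (upTo (suc n))

  -- Nair's argument: `(2k+1) C(2k, k)` divides every common multiple of 1, ..., n, and the product
  -- of the maximal prime powers up to `n` is one, with each of its π(n) factors at most `n`.
  2^k≤n^π : ∀ k n → k + k < n → 2 ^ k ≤ n ^ length (primesUpTo n)
  2^k≤n^π k n 2k<n = begin
    2 ^ k                        ≤⟨ 2^k≤2kCk k ⟩
    (k + k) C k                  ≤⟨ m≤n*m _ (suc (k + k)) ⟩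
    suc (k + k) * ((k + k) C k)  ≤⟨ ∣⇒≤ {{>-nonZero 1≤W}} (leibniz-∣ W n W-multiple k (k + k) 2k<n (m≤m+n k k)) ⟩
    W                            ≤⟨ W≤ ⟩
    n ^ length (primesUpTo n)    ∎
    where
    open ≤-Reasoning
    common = commonMultiple n (primesUpTo n) (≤-<-trans z≤n 2k<n) (all-filter prime? (upTo (suc n)))
    W = proj₁ common
    W≤ = proj₁ (proj₂ common)
    1≤W = proj₁ (proj₂ (proj₂ common))
    W-multiple : ∀ i → 1 ≤ i → i ≤ n → i ∣ W
    W-multiple i 1≤i i≤n = proj₂ (proj₂ (proj₂ common)) i 1≤i i≤n λ p p-prime p∣i →
      ∈-filter⁺ prime? (∈-upTo⁺ (s≤s (≤-trans (∣⇒≤ {{>-nonZero 1≤i}} p∣i) i≤n))) p-prime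

  -- Finite sums and the Cauchy–Schwarz inequality

  +-interchange : ∀ a b c d → a + b + (c + d) ≡ a + c + (b + d)
  +-interchange = solve-∀

  𝟙 : ∀ {p} {P : Set p} → Dec P → ℕ
  𝟙 (yes _) = 1
  𝟙 (no  _) = 0

  module _ {A : Set} where

    ∑ᴸ : List A → (A → ℕ) → ℕ
    ∑ᴸ xs f = sum (map f xs)

    ∑ᴸ-mono : ∀ {f g : A → ℕ} {xs} → All (λ x → f x ≤ g x) xs → ∑ᴸ xs f ≤ ∑ᴸ xs g
    ∑ᴸ-mono []         = z≤n
    ∑ᴸ-mono (h ∷ hs) = +-mono-≤ h (∑ᴸ-mono hs)

    ∑ᴸ-cong : ∀ {f g : A → ℕ} {xs} → All (λ x → f x ≡ g x) xs → ∑ᴸ xs f ≡ ∑ᴸ xs g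
    ∑ᴸ-cong []       = refl
    ∑ᴸ-cong (h ∷ hs) = cong₂ _+_ h (∑ᴸ-cong hs)

    ∑ᴸ-const : ∀ xs c → ∑ᴸ xs (λ _ → c) ≡ length xs * c
    ∑ᴸ-const []       c = refl
    ∑ᴸ-const (_ ∷ xs) c = cong (c +_) (∑ᴸ-const xs c)

    ∑ᴸ-+ : ∀ xs (f g : A → ℕ) → ∑ᴸ xs (λ x → f x + g x) ≡ ∑ᴸ xs f + ∑ᴸ xs g
    ∑ᴸ-+ []       f g = refl
    ∑ᴸ-+ (x ∷ xs) f g = trans (cong (f x + g x +_) (∑ᴸ-+ xs f g)) (+-interchange (f x) (g x) _ _)

    *-∑ᴸ : ∀ c xs (f : A → ℕ) → c * ∑ᴸ xs f ≡ ∑ᴸ xs (λ x → c * f x)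
    *-∑ᴸ c []       f = *-zeroʳ c
    *-∑ᴸ c (x ∷ xs) f = trans (*-distribˡ-+ c (f x) _) (cong (c * f x +_) (*-∑ᴸ c xs f))

    ∑ᴸ-𝟙 : ∀ {p} {P : Pred A p} (P? : Decidable P) xs → ∑ᴸ xs (λ x → 𝟙 (P? x)) ≡ length (filter P? xs)
    ∑ᴸ-𝟙 P? [] = refl
    ∑ᴸ-𝟙 P? (x ∷ xs) with P? x
    ... | yes _ = cong suc (∑ᴸ-𝟙 P? xs)
    ... | no  _ = ∑ᴸ-𝟙 P? xs

    lookup-injective : ∀ {xs : List A} → Unique xs → ∀ i j → lookup xs i ≡ lookup xs j → i ≡ j
    lookup-injective (_ ∷ _)  zero    zero    _  = refl
    lookup-injective (x∉ ∷ _) zero    (suc j) eq = contradiction eq (All.lookup x∉ (∈-lookup j))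
    lookup-injective (x∉ ∷ _) (suc i) zero    eq = contradiction (sym eq) (All.lookup x∉ (∈-lookup i))
    lookup-injective (_ ∷ u)  (suc i) (suc j) eq = cong suc (lookup-injective u i j eq)

    -- Pigeonhole for a list without repetition. `code` has to be injective only on elements
    -- satisfying `P`, which is how solutions of a congruence are counted.
    length≤ : ∀ {p} {P : Pred A p} {xs : List A} {K} → Unique xs → All P xs →
      (code : A → ℕ) → (∀ {x} → P x → code x < K) →
      (∀ {x y} → P x → P y → code x ≡ code y → x ≡ y) → length xs ≤ K
    length≤ {P = P} {xs} {K} unique all code code<K code-inj =
      Fin.injective⇒≤ {f = f} λ {i} {j} eq → lookup-injective unique i j
        (code-inj (Pᵢ i) (Pᵢ j) (Fin.fromℕ<-injective _ _ (code<K (Pᵢ i)) (code<K (Pᵢ j)) eq))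
      where
      Pᵢ : ∀ i → P (lookup xs i)
      Pᵢ i = All.lookup all (∈-lookup i)
      f : Fin (length xs) → Fin K
      f i = fromℕ< (code<K (Pᵢ i))

    length-filter≤ : ∀ {p q} {P : Pred A p} {Q : Pred A q} (P? : Decidable P) (xs : List A) {K} →
      Unique xs → All Q xs → (code : A → ℕ) → (∀ {x} → P x → Q x → code x < K) →
      (∀ {x y} → P x → Q x → P y → Q y → code x ≡ code y → x ≡ y) → length (filter P? xs) ≤ K
    length-filter≤ P? xs unique all code code<K code-inj =
      length≤ (filter⁺ P? unique) (All.zip (all-filter P? xs , all-filter⁺ P? all)) code
        (λ (p , q) → code<K p q) (λ (p , q) (p′ , q′) → code-inj p q p′ q′)

  module _ {A B : Set} where

    ∑ᴸ-swap : ∀ (xs : List A) (ys : List B) (f : A → B → ℕ) →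
      ∑ᴸ xs (λ x → ∑ᴸ ys (f x)) ≡ ∑ᴸ ys (λ y → ∑ᴸ xs (λ x → f x y))
    ∑ᴸ-swap []       ys f = sym (trans (∑ᴸ-const ys 0) (*-zeroʳ (length ys)))
    ∑ᴸ-swap (x ∷ xs) ys f = trans (cong (∑ᴸ ys (f x) +_) (∑ᴸ-swap xs ys f))
      (sym (∑ᴸ-+ ys (f x) (λ y → ∑ᴸ xs (λ x → f x y))))

    ∑ᴸ-× : ∀ (xs : List A) (ys : List B) (f : A × B → ℕ) →
      ∑ᴸ (cartesianProduct xs ys) f ≡ ∑ᴸ xs (λ x → ∑ᴸ ys (λ y → f (x , y)))
    ∑ᴸ-× []       ys f = refl
    ∑ᴸ-× (x ∷ xs) ys f = begin
      sum (map f (map (x ,_) ys ++ cartesianProduct xs ys))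
        ≡⟨ cong sum (map-++ f (map (x ,_) ys) _) ⟩
      sum (map f (map (x ,_) ys) ++ map f (cartesianProduct xs ys))
        ≡⟨ sum-++ (map f (map (x ,_) ys)) _ ⟩
      sum (map f (map (x ,_) ys)) + ∑ᴸ (cartesianProduct xs ys) f
        ≡⟨ cong₂ _+_ (cong sum (sym (map-∘ ys))) (∑ᴸ-× xs ys f) ⟩
      ∑ᴸ ys (λ y → f (x , y)) + ∑ᴸ xs (λ x → ∑ᴸ ys (λ y → f (x , y))) ∎
      where open ≡-Reasoning

    length-cartesianProduct : ∀ (xs : List A) (ys : List B) →
      length (cartesianProduct xs ys) ≡ length xs * length ys
    length-cartesianProduct []       ys = refl
    length-cartesianProduct (x ∷ xs) ys = trans (length-++ (map (x ,_) ys))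
      (cong₂ _+_ (length-map (x ,_) ys) (length-cartesianProduct xs ys))

  ∑ˢ : ∀ {m} → Subset m → (Fin m → ℕ) → ℕ
  ∑ˢ []            f = 0
  ∑ˢ (inside  ∷ A) f = f zero + ∑ˢ A (f ∘ suc)
  ∑ˢ (outside ∷ A) f = ∑ˢ A (f ∘ suc)

  ∑ˢ-cong : ∀ {m} (A : Subset m) {f g : Fin m → ℕ} → (∀ i → f i ≡ g i) → ∑ˢ A f ≡ ∑ˢ A g
  ∑ˢ-cong []            h = refl
  ∑ˢ-cong (inside  ∷ A) h = cong₂ _+_ (h zero) (∑ˢ-cong A (h ∘ suc))
  ∑ˢ-cong (outside ∷ A) h = ∑ˢ-cong A (h ∘ suc)

  ∑ˢ-+ : ∀ {m} (A : Subset m) (f g : Fin m → ℕ) → ∑ˢ A (λ i → f i + g i) ≡ ∑ˢ A f + ∑ˢ A g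
  ∑ˢ-+ []            f g = refl
  ∑ˢ-+ (inside  ∷ A) f g = trans (cong (f zero + g zero +_) (∑ˢ-+ A (f ∘ suc) (g ∘ suc)))
    (+-interchange (f zero) (g zero) _ _)
  ∑ˢ-+ (outside ∷ A) f g = ∑ˢ-+ A (f ∘ suc) (g ∘ suc)

  ∑ˢ-0 : ∀ {m} (A : Subset m) → ∑ˢ A (λ _ → 0) ≡ 0
  ∑ˢ-0 []            = refl
  ∑ˢ-0 (inside  ∷ A) = ∑ˢ-0 A
  ∑ˢ-0 (outside ∷ A) = ∑ˢ-0 A

  ∑ˢ-∑ᴸ : ∀ {m} (A : Subset m) {B : Set} (xs : List B) (f : B → Fin m → ℕ) →
    ∑ˢ A (λ i → ∑ᴸ xs (λ x → f x i)) ≡ ∑ᴸ xs (λ x → ∑ˢ A (f x))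
  ∑ˢ-∑ᴸ A []       f = ∑ˢ-0 A
  ∑ˢ-∑ᴸ A (x ∷ xs) f = trans (∑ˢ-+ A (f x) _) (cong (∑ˢ A (f x) +_) (∑ˢ-∑ᴸ A xs f))

  𝟙-suc : ∀ {m} (i j : Fin m) → 𝟙 (suc i Fin.≟ suc j) ≡ 𝟙 (i Fin.≟ j)
  𝟙-suc i j with i Fin.≟ j
  ... | yes _ = refl
  ... | no  _ = refl

  ∑ˢ-select : ∀ {m} (A : Subset m) (g : Fin m → ℕ) {i} → i ∈ˢ A → ∑ˢ A (λ j → 𝟙 (i Fin.≟ j) * g j) ≡ g i
  ∑ˢ-select (inside ∷ A) g here =
    trans (cong₂ _+_ (+-identityʳ (g zero)) (∑ˢ-0 A)) (+-identityʳ (g zero))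
  ∑ˢ-select (inside ∷ A) g {suc i} (there i∈A) =
    trans (∑ˢ-cong A (λ j → cong (_* g (suc j)) (𝟙-suc i j))) (∑ˢ-select A (g ∘ suc) i∈A)
  ∑ˢ-select (outside ∷ A) g {suc i} (there i∈A) =
    trans (∑ˢ-cong A (λ j → cong (_* g (suc j)) (𝟙-suc i j))) (∑ˢ-select A (g ∘ suc) i∈A)

  2ab≤a²+b² : ∀ a b → 2 * (a * b) ≤ a * a + b * b
  2ab≤a²+b² a b = [ (λ h → go a b h) , (λ h → subst₂ _≤_ (cong (2 *_) (*-comm b a)) (+-comm (b * b) (a * a)) (go b a h)) ]′ (≤-total a b)
    where
    expand : ∀ a c → a * a + (a + c) * (a + c) ≡ 2 * (a * (a + c)) + c * c
    expand = solve-∀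
    go : ∀ a b → a ≤ b → 2 * (a * b) ≤ a * a + b * b
    go a b a≤b = subst (λ b → 2 * (a * b) ≤ a * a + b * b) (m+[n∸m]≡n a≤b)
      (≤-trans (m≤m+n _ ((b ∸ a) * (b ∸ a))) (≤-reflexive (sym (expand a (b ∸ a)))))

  -- Summed form of 2 c f ≤ c² + f². With `c` the first value of `f` it controls the cross terms in
  -- the induction for Cauchy-Schwarz.
  ∑ˢ-AM-GM : ∀ {m} (A : Subset m) (f : Fin m → ℕ) c →
    2 * (c * ∑ˢ A f) ≤ card A * (c * c) + ∑ˢ A (λ i → f i * f i)
  ∑ˢ-AM-GM [] f c = ≤-reflexive (cong (2 *_) (*-zeroʳ c))
  ∑ˢ-AM-GM (outside ∷ A) f c = ∑ˢ-AM-GM A (f ∘ suc) c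
  ∑ˢ-AM-GM (inside ∷ A) f c = begin
    2 * (c * (a + F))                    ≡⟨ split c a F ⟩
    2 * (c * a) + 2 * (c * F)            ≤⟨ +-mono-≤ (2ab≤a²+b² c a) (∑ˢ-AM-GM A (f ∘ suc) c) ⟩
    (c * c + a * a) + (n * (c * c) + G)  ≡⟨ regroup (c * c) (a * a) (n * (c * c)) G ⟩
    suc n * (c * c) + (a * a + G)        ∎
    where
    open ≤-Reasoning
    a = f zero
    n = card A
    F = ∑ˢ A (f ∘ suc)
    G = ∑ˢ A (λ i → f (suc i) * f (suc i))
    split : ∀ c a F → 2 * (c * (a + F)) ≡ 2 * (c * a) + 2 * (c * F)
    split = solve-∀
    regroup : ∀ x y z w → x + y + (z + w) ≡ x + z + (y + w)
    regroup = solve-∀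

  cauchySchwarz : ∀ {m} (A : Subset m) (f : Fin m → ℕ) →
    ∑ˢ A f * ∑ˢ A f ≤ card A * ∑ˢ A (λ i → f i * f i)
  cauchySchwarz [] f = z≤n
  cauchySchwarz (outside ∷ A) f = cauchySchwarz A (f ∘ suc)
  cauchySchwarz (inside ∷ A) f = begin
    (a + F) * (a + F)                        ≡⟨ expand a F ⟩
    a * a + 2 * (a * F) + F * F              ≤⟨ +-mono-≤ (+-monoʳ-≤ (a * a) (∑ˢ-AM-GM A (f ∘ suc) a))
                                                  (cauchySchwarz A (f ∘ suc)) ⟩
    a * a + (n * (a * a) + G) + n * G        ≡⟨ regroup (a * a) n G ⟩
    suc n * (a * a + G)                      ∎
    where
    open ≤-Reasoning
    a = f zero
    n = card A
    F = ∑ˢ A (f ∘ suc)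
    G = ∑ˢ A (λ i → f (suc i) * f (suc i))
    expand : ∀ a F → (a + F) * (a + F) ≡ a * a + 2 * (a * F) + F * F
    expand = solve-∀
    regroup : ∀ x n G → x + (n * x + G) + n * G ≡ suc n * (x + G)
    regroup = solve-∀

  module _ {m} {Z : Set} (ρ : Z → Fin m) (zs : List Z) where

    collisions : ℕ
    collisions = ∑ᴸ zs λ z → ∑ᴸ zs λ z′ → 𝟙 (ρ z′ Fin.≟ ρ z)

    -- Cauchy-Schwarz for the fibre sizes of `ρ`: they add up to `length zs` because all values lie
    -- in `A`, and their squares add up to the ordered collisions, diagonal included.
    length²≤card*collisions : ∀ A → All (λ z → ρ z ∈ˢ A) zs →
      length zs * length zs ≤ card A * collisions
    length²≤card*collisions A ρ∈A = subst₂ (λ a b → a * a ≤ card A * b) ∑f ∑f² (cauchySchwarz A f)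
      where
      open ≡-Reasoning
      f : Fin m → ℕ
      f r = ∑ᴸ zs λ z → 𝟙 (ρ z Fin.≟ r)
      ∑f : ∑ˢ A f ≡ length zs
      ∑f = begin
        ∑ˢ A f
          ≡⟨ ∑ˢ-∑ᴸ A zs (λ z r → 𝟙 (ρ z Fin.≟ r)) ⟩
        ∑ᴸ zs (λ z → ∑ˢ A (λ r → 𝟙 (ρ z Fin.≟ r)))
          ≡⟨ ∑ᴸ-cong (All.map (λ z∈ → trans (∑ˢ-cong A (λ r → sym (*-identityʳ _)))
               (∑ˢ-select A (λ _ → 1) z∈)) ρ∈A) ⟩
        ∑ᴸ zs (λ _ → 1)
          ≡⟨ trans (∑ᴸ-const zs 1) (*-identityʳ (length zs)) ⟩
        length zs ∎
      ∑f² : ∑ˢ A (λ r → f r * f r) ≡ collisions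
      ∑f² = begin
        ∑ˢ A (λ r → f r * f r)
          ≡⟨ ∑ˢ-cong A (λ r → trans (*-∑ᴸ (f r) zs _)
               (∑ᴸ-cong {xs = zs} (All.universal (λ z → *-comm (f r) _) zs))) ⟩
        ∑ˢ A (λ r → ∑ᴸ zs (λ z → 𝟙 (ρ z Fin.≟ r) * f r))
          ≡⟨ ∑ˢ-∑ᴸ A zs (λ z r → 𝟙 (ρ z Fin.≟ r) * f r) ⟩
        ∑ᴸ zs (λ z → ∑ˢ A (λ r → 𝟙 (ρ z Fin.≟ r) * f r))
          ≡⟨ ∑ᴸ-cong (All.map (∑ˢ-select A f) ρ∈A) ⟩
        collisions ∎

  -- Congruences

  -- Congruences in `ℕ` are witnessed by multiples of `m` added on both sides, so nothing is
  -- subtracted; `%-elim` recovers such witnesses from the quotients.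
  %-intro : ∀ m .{{_ : NonZero m}} {a b} k l → a + k * m ≡ b + l * m → a % m ≡ b % m
  %-intro m {a} {b} k l eq =
    trans (sym ([m+kn]%n≡m%n a k m)) (trans (cong (_% m) eq) ([m+kn]%n≡m%n b l m))

  %-elim : ∀ m .{{_ : NonZero m}} {a b} → a % m ≡ b % m → a + (b / m) * m ≡ b + (a / m) * m
  %-elim m {a} {b} eq = begin
    a + b / m * m                    ≡⟨ cong (_+ b / m * m) (m≡m%n+[m/n]*n a m) ⟩
    a % m + a / m * m + b / m * m    ≡⟨ cong (λ r → r + a / m * m + b / m * m) eq ⟩
    b % m + a / m * m + b / m * m    ≡⟨ swap (b % m) (a / m * m) (b / m * m) ⟩
    b % m + b / m * m + a / m * m    ≡⟨ cong (_+ a / m * m) (m≡m%n+[m/n]*n b m) ⟨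
    b + a / m * m                    ∎
    where
    open ≡-Reasoning
    swap : ∀ x y z → x + y + z ≡ x + z + y
    swap = solve-∀

  %-cancel-+ : ∀ m .{{_ : NonZero m}} {a b x y} →
    (a + x) % m ≡ (b + y) % m → x % m ≡ y % m → a % m ≡ b % m
  %-cancel-+ m {a} {b} {x} {y} h h′ = %-intro m (k + l′) (l + k′) (+-cancelʳ-≡ x _ _ (begin
    a + (k + l′) * m + x      ≡⟨ lhs a k l′ m x ⟩
    a + x + k * m + l′ * m    ≡⟨ cong (_+ l′ * m) (%-elim m h) ⟩
    b + y + l * m + l′ * m    ≡⟨ mid b y l l′ m ⟩
    b + l * m + (y + l′ * m)  ≡⟨ cong (b + l * m +_) (%-elim m h′) ⟨
    b + l * m + (x + k′ * m)  ≡⟨ rhs b l k′ m x ⟩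
    b + (l + k′) * m + x      ∎))
    where
    open ≡-Reasoning
    k = (b + y) / m
    l = (a + x) / m
    k′ = y / m
    l′ = x / m
    lhs : ∀ a k l′ m x → a + (k + l′) * m + x ≡ a + x + k * m + l′ * m
    lhs = solve-∀
    mid : ∀ b y l l′ m → b + y + l * m + l′ * m ≡ b + l * m + (y + l′ * m)
    mid = solve-∀
    rhs : ∀ b l k′ m x → b + l * m + (x + k′ * m) ≡ b + (l + k′) * m + x
    rhs = solve-∀

  %-≡⇒∣∸ : ∀ m .{{_ : NonZero m}} {a b} → a ≤ b → a % m ≡ b % m → m ∣ b ∸ a
  %-≡⇒∣∸ m {a} {b} a≤b eq = ∣m+n∣m⇒∣n {m = a / m * m} (divides (b / m) (+-cancelˡ-≡ a _ _ (begin
    a + (a / m * m + (b ∸ a))  ≡⟨ shuffle a (a / m * m) (b ∸ a) ⟩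
    a + (b ∸ a) + a / m * m    ≡⟨ cong (_+ a / m * m) (m+[n∸m]≡n a≤b) ⟩
    b + a / m * m              ≡⟨ %-elim m eq ⟨
    a + b / m * m              ∎))) (divides (a / m) refl)
    where
    open ≡-Reasoning
    shuffle : ∀ x y z → x + (y + z) ≡ x + z + y
    shuffle = solve-∀

  -- Coprimality passes the divisor `m` from `q (b - a)` to `b - a`, which is less than `m` and
  -- hence zero.
  %-cancel-* : ∀ m .{{_ : NonZero m}} q {a b} → Coprime m q → a < m → b < m →
    (q * a) % m ≡ (q * b) % m → a ≡ b
  %-cancel-* m q {a} {b} coprime a<m b<m eq = [ (λ h → go h b<m eq) , (λ h → sym (go h a<m (sym eq))) ]′ (≤-total a b)
    where
    go : ∀ {a b} → a ≤ b → b < m → (q * a) % m ≡ (q * b) % m → a ≡ b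
    go {a} {b} a≤b b<m eq = ≤-antisym a≤b (m∸n≡0⇒m≤n (∣-<⇒≡0 (b ∸ a) (≤-<-trans (m∸n≤m b a) b<m)
      (coprime-divisor coprime
        (subst (m ∣_) (sym (*-distribˡ-∸ q b a)) (%-≡⇒∣∸ m (*-monoʳ-≤ q a≤b) eq)))))
      where
      ∣-<⇒≡0 : ∀ n → n < m → m ∣ n → n ≡ 0
      ∣-<⇒≡0 zero    _   _   = refl
      ∣-<⇒≡0 (suc n) n<m m∣n = contradiction m∣n (>⇒∤ n<m)

  prime∤⇒coprime : ∀ {p n} → Prime p → p ∤ n → Coprime n p
  prime∤⇒coprime p-prime p∤n (d∣n , d∣p) with prime⇒irreducible p-prime d∣p
  ... | inj₁ d≡1 = d≡1
  ... | inj₂ refl = contradiction d∣n p∤n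

  primes-coprime : ∀ {p q} → Prime p → Prime q → p ≢ q → Coprime q p
  primes-coprime p-prime q-prime p≢q = prime∤⇒coprime p-prime λ p∣q →
    [ (λ { refl → ¬prime[1] p-prime }) , p≢q ]′ (prime⇒irreducible q-prime p∣q)


  -- Solutions of q y ≡ q′ y′ in the interval

  module PairCounts (m : ℕ) .{{_ : NonZero m}} (s H : ℕ) where

    -- `s` will be the least residue of S + 1, so that `j` stands for y = S + 1 + j and the interval
    -- becomes `j < H`.
    ρ : ℕ × ℕ → Fin m
    ρ (q , j) = fromℕ< (m%n<n (q * (s + j)) m)

    ρ≡⇒%≡ : ∀ q j q′ j′ → ρ (q , j) ≡ ρ (q′ , j′) → (q * (s + j)) % m ≡ (q′ * (s + j′)) % m
    ρ≡⇒%≡ _ _ _ _ = Fin.fromℕ<-injective _ _ _ _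

    box : List (ℕ × ℕ)
    box = cartesianProduct (upTo H) (upTo H)

    box-unique : Unique box
    box-unique = cartesianProduct⁺ (upTo⁺ H) (upTo⁺ H)

    InBox : Pred (ℕ × ℕ) _
    InBox (j , j′) = j < H × j′ < H

    box-bounds : All InBox box
    box-bounds = All.tabulate λ j∈ → let a , b = ∈-cartesianProduct⁻ (upTo H) (upTo H) j∈ in
      ∈-upTo⁻ a , ∈-upTo⁻ b

    pairCount : ℕ → ℕ → ℕ
    pairCount q q′ = ∑ᴸ (upTo H) λ j → ∑ᴸ (upTo H) λ j′ → 𝟙 (ρ (q′ , j′) Fin.≟ ρ (q , j))

    Meets : ℕ → ℕ → Pred (ℕ × ℕ) _
    Meets q q′ (j , j′) = ρ (q′ , j′) ≡ ρ (q , j)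

    meets? : ∀ q q′ → Decidable (Meets q q′)
    meets? q q′ (j , j′) = ρ (q′ , j′) Fin.≟ ρ (q , j)

    pairCount≡ : ∀ q q′ → pairCount q q′ ≡ length (filter (meets? q q′) box)
    pairCount≡ q q′ = trans (sym (∑ᴸ-× (upTo H) (upTo H) _)) (∑ᴸ-𝟙 (meets? q q′) box)

    -- As `q` is invertible modulo `m` and `H ≤ m`, the first coordinate determines the second.
    pairCount-diagonal : ∀ {q} → Prime q → q ∤ m → H ≤ m → pairCount q q ≤ H
    pairCount-diagonal {q} q-prime q∤m H≤m = ≤-trans (≤-reflexive (pairCount≡ q q))
      (length-filter≤ (meets? q q) box box-unique box-bounds proj₁
        (λ _ (j<H , _) → j<H)
        λ { {j , j′} {.j , k′} e (_ , j′<H) f (_ , k′<H) refl → cong (j ,_)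
          (%-cancel-* m q (prime∤⇒coprime q-prime q∤m) (<-≤-trans j′<H H≤m) (<-≤-trans k′<H H≤m)
            (%-cancel-+ m
              (trans (cong (_% m) (trans (+-comm (q * j′) (q * s)) (sym (*-distribˡ-+ q s j′))))
                (trans (ρ≡⇒%≡ q j′ q k′ (trans e (sym f)))
                  (cong (_% m) (trans (*-distribˡ-+ q s k′) (+-comm (q * s) (q * k′))))))
              refl)) })

    -- A solution of q(s+j) ≡ q′(s+j′) is determined by β = ⌊j/q′⌋ and ⌊v/m⌋, where
    -- v = q′j′ + q(q′-1-i) and j = βq′ + i: modulo m, v depends only on β; so v is
    -- determined, hence i (as q is invertible modulo q′), hence j and j′.
    pairCount-offDiagonal : ∀ {q q′} → Prime q → (pr : Prime q′) → q ≢ q′ →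
      m * pairCount q q′ ≤ suc ((H / q′) {{prime⇒nonZero pr}}) * m + (H + q′) * (H + q)
    pairCount-offDiagonal {q} {q′} q-prime q′-prime q≢q′ = begin
      m * pairCount q q′        ≡⟨ cong (m *_) (pairCount≡ q q′) ⟩
      m * length (filter (meets? q q′) box)
        ≤⟨ *-monoʳ-≤ m (length-filter≤ (meets? q q′) box box-unique box-bounds code
             (λ _ bounds → code< bounds) code-injective) ⟩
      -- T m ≤ m + V, and then b q′ ≤ H + q′: the leading term is H² with coefficient 1.
      m * (T * b)               ≡⟨ rearrange m (V / m) b ⟩
      b * (m + (V / m) * m)     ≤⟨ *-monoʳ-≤ b (+-monoʳ-≤ m (m/n*n≤m V m)) ⟩
      b * (m + q′ * (H + q))    ≡⟨ expand (H / q′) m q′ (H + q) ⟩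
      b * m + (q′ + H / q′ * q′) * (H + q)
        ≤⟨ +-monoʳ-≤ (b * m) (*-monoˡ-≤ (H + q)
             (≤-trans (+-monoʳ-≤ q′ (m/n*n≤m H q′)) (≤-reflexive (+-comm q′ H)))) ⟩
      b * m + (H + q′) * (H + q) ∎
      where
      open ≤-Reasoning
      instance
        q′≢0 : NonZero q′
        q′≢0 = prime⇒nonZero q′-prime
      b V T : ℕ
      b = suc (H / q′)
      V = q′ * (H + q)
      T = suc (V / m)
      rearrange : ∀ m v b → m * (suc v * b) ≡ b * (m + v * m)
      rearrange = solve-∀
      expand : ∀ b m q′ h → suc b * (m + q′ * h) ≡ suc b * m + (q′ + b * q′) * h
      expand = solve-∀
      -- The complement q′ - 1 - i replaces -i, keeping `v` a natural number.
      î : ℕ → ℕ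
      î j = q′ ∸ suc (j % q′)
      î<q′ : ∀ j → î j < q′
      î<q′ j = ∸-monoʳ-< {q′} {suc (j % q′)} {0} (s≤s z≤n) (m%n<n j q′)
      i+î : ∀ j → suc (j % q′) + î j ≡ q′
      i+î j = m+[n∸m]≡n (m%n<n j q′)
      v : ℕ × ℕ → ℕ
      v (j , j′) = q′ * j′ + q * î j
      -- Mixed radix: the low digit β is below `b`, the high digit ⌊v/m⌋ below `T`.
      code : ℕ × ℕ → ℕ
      code x@(j , j′) = j / q′ + v x / m * b
      β<b : ∀ {j} → j < H → j / q′ < b
      β<b j<H = s≤s (/-monoˡ-≤ q′ (<⇒≤ j<H))
      code< : ∀ {x} → InBox x → code x < T * b
      code< {x@(j , j′)} (j<H , j′<H) = begin-strict
        j / q′ + v x / m * b   <⟨ +-monoˡ-< (v x / m * b) (β<b j<H) ⟩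
        suc (v x / m) * b      ≤⟨ *-monoˡ-≤ b (s≤s (/-monoˡ-≤ m v≤V)) ⟩
        T * b                  ∎
        where
        v≤V : v x ≤ V
        v≤V = ≤-trans (+-mono-≤ (*-monoʳ-≤ q′ (<⇒≤ j′<H)) (*-monoʳ-≤ q (<⇒≤ (î<q′ j))))
          (≤-reflexive (trans (cong (q′ * H +_) (*-comm q q′)) (sym (*-distribˡ-+ q′ H q))))
      -- Since suc i + î = q′, adding q (s + j) to `v` absorbs `i`; the right-hand side sees `j`
      -- only through ⌊j/q′⌋.
      v-residue : ∀ {j j′} → ρ (q′ , j′) ≡ ρ (q , j) →
        (v (j , j′) + (q′ * s + q)) % m ≡ (q * q′ + q * (s + j / q′ * q′)) % m
      v-residue {j} {j′} e = %-cancel-+ m (cong (_% m) eq) (sym (ρ≡⇒%≡ q′ j′ q j e))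
        where
        split : ∀ q q′ s i î β j′ → q′ * j′ + q * î + (q′ * s + q) + q * (s + (i + β * q′)) ≡
                q * (suc i + î) + q * (s + β * q′) + q′ * (s + j′)
        split = solve-∀
        eq : v (j , j′) + (q′ * s + q) + q * (s + j) ≡
             q * q′ + q * (s + j / q′ * q′) + q′ * (s + j′)
        eq = trans (cong (λ k → v (j , j′) + (q′ * s + q) + q * (s + k)) (m≡m%n+[m/n]*n j q′))
          (trans (split q q′ s (j % q′) (î j) (j / q′) j′)
            (cong (λ k → q * k + q * (s + j / q′ * q′) + q′ * (s + j′)) (i+î j)))
      code-injective : ∀ {x y} →
        Meets q q′ x → InBox x →
        Meets q q′ y → InBox y →
        code x ≡ code y → x ≡ y
      code-injective {x@(j , j′)} {y@(k , k′)} e (j<H , _) f (k<H , _) eq = cong₂ _,_ j≡k j′≡k′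
        where
        β-of : ∀ {β} τ → β < b → (β + τ * b) % b ≡ β
        β-of {β} τ β<b = trans ([m+kn]%n≡m%n β τ b) (m<n⇒m%n≡m β<b)
        β≡ : j / q′ ≡ k / q′
        β≡ = trans (sym (β-of (v x / m) (β<b j<H))) (trans (cong (_% b) eq) (β-of (v y / m) (β<b k<H)))
        τ≡ : v x / m ≡ v y / m
        τ≡ = *-cancelʳ-≡ (v x / m) (v y / m) b
          (+-cancelˡ-≡ (j / q′) _ _ (trans eq (cong (_+ v y / m * b) (sym β≡))))
        v%≡ : v x % m ≡ v y % m
        v%≡ = %-cancel-+ m (trans (v-residue {j} {j′} e) (trans
          (cong (λ β → (q * q′ + q * (s + β * q′)) % m) β≡) (sym (v-residue {k} {k′} f)))) refl
        v≡ : v x ≡ v y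
        v≡ = trans (m≡m%n+[m/n]*n (v x) m) (trans (cong₂ (λ r t → r + t * m) v%≡ τ≡)
          (sym (m≡m%n+[m/n]*n (v y) m)))
        î≡ : î j ≡ î k
        î≡ = %-cancel-* q′ q (primes-coprime q-prime q′-prime q≢q′) (î<q′ j) (î<q′ k)
          (%-intro q′ j′ k′ (trans (comm q (î j) q′ j′) (trans v≡ (sym (comm q (î k) q′ k′)))))
          where
          comm : ∀ q i q′ j → q * i + j * q′ ≡ q′ * j + q * i
          comm = solve-∀
        i≡ : j % q′ ≡ k % q′
        i≡ = suc-injective (+-cancelʳ-≡ (î j) _ _ (trans (i+î j)
          (trans (sym (i+î k)) (cong (suc (k % q′) +_) (sym î≡)))))
        j≡k : j ≡ k
        j≡k = trans (m≡m%n+[m/n]*n j q′) (trans (cong₂ (λ r t → r + t * q′) i≡ β≡)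
          (sym (m≡m%n+[m/n]*n k q′)))
        j′≡k′ : j′ ≡ k′
        j′≡k′ = *-cancelˡ-≡ j′ k′ q′ (+-cancelʳ-≡ (q * î j) _ _
          (trans v≡ (cong (λ i → q′ * k′ + q * i) (sym î≡))))

  -- The second moment

  -- A list without repetition meets `a` at most once, so `D` is charged once. It separates the
  -- diagonal prime from the others.
  ∑ᴸ-exceptOne : ∀ {xs} a (g : ℕ → ℕ) {D R} → Unique xs →
    (∀ {x} → x ∈ xs → x ≡ a → g x ≤ D) → (∀ {x} → x ∈ xs → x ≢ a → g x ≤ R) →
    ∑ᴸ xs g ≤ D + length xs * R
  ∑ᴸ-exceptOne a g [] _ _ = z≤n
  ∑ᴸ-exceptOne {x ∷ xs} a g {D} {R} (x∉xs ∷ unique) hD hR with x ≟ a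
  ... | yes refl = +-mono-≤ (hD (here refl) refl) (≤-trans
        (∑ᴸ-mono (All.tabulate λ y∈ → hR (there y∈) (≢-sym (All.lookup x∉xs y∈))))
        (≤-trans (≤-reflexive (∑ᴸ-const xs R)) (m≤n+m _ R)))
  ... | no x≢a = ≤-trans (+-mono-≤ (hR (here refl) x≢a)
        (∑ᴸ-exceptOne a g unique (hD ∘ there) (hR ∘ there)))
        (≤-reflexive (swap R D (length xs * R)))
        where
        swap : ∀ a b c → a + (b + c) ≡ b + (a + c)
        swap = solve-∀

  module Covering (m : ℕ) .{{_ : NonZero m}} (s H : ℕ) where

    open PairCounts m s H

    collisions≡∑pairCount : ∀ ps →
      collisions ρ (cartesianProduct ps (upTo H)) ≡ ∑ᴸ ps λ q → ∑ᴸ ps λ q′ → pairCount q q′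
    collisions≡∑pairCount ps = trans (∑ᴸ-× ps (upTo H) _) (∑ᴸ-cong (All.universal (λ q →
      trans (∑ᴸ-cong (All.universal (λ j → ∑ᴸ-× ps (upTo H) _) (upTo H)))
        (∑ᴸ-swap (upTo H) ps _)) ps))

    module _ (A : Subset m) (ps : List ℕ) (covered : ∀ {q j} → q ∈ ps → j < H → ρ (q , j) ∈ˢ A) where

      secondMoment : (length ps * H) * (length ps * H) ≤
                     card A * ∑ᴸ ps (λ q → ∑ᴸ ps λ q′ → pairCount q q′)
      secondMoment = subst₂ (λ a b → a * a ≤ card A * b)
        (trans (length-cartesianProduct ps (upTo H)) (cong (length ps *_) (length-upTo H)))
        (collisions≡∑pairCount ps)
        (length²≤card*collisions ρ (cartesianProduct ps (upTo H)) A
          (All.tabulate λ z∈ → let q∈ , j∈ = ∈-cartesianProduct⁻ ps (upTo H) z∈ in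
            covered q∈ (∈-upTo⁻ j∈)))

      module _ {X : ℕ} (unique : Unique ps) (ps≢[] : 1 ≤ length ps)
               (good : All (λ q → Prime q × q ∤ m × length ps ≤ q × q ≤ X) ps)
               (Q≤X : length ps ≤ X) (X²≤m : X * X ≤ m) (X≤H : X ≤ H) (H≤m : H ≤ m) where

        private
          Q R : ℕ
          Q = length ps
          instance
            Q≢0 : NonZero Q
            Q≢0 = >-nonZero ps≢[]
          R = suc (H / Q) * m + (H + X) * (H + X)

        m*pairCount≤R : ∀ {q q′} → q ∈ ps → q′ ∈ ps → q ≢ q′ → m * pairCount q q′ ≤ R
        m*pairCount≤R {q} {q′} q∈ q′∈ q≢q′ with All.lookup good q∈ | All.lookup good q′∈
        ... | q-prime , _ , _ , q≤X | q′-prime , _ , Q≤q′ , q′≤X = ≤-trans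
          (pairCount-offDiagonal q-prime q′-prime q≢q′)
          (+-mono-≤ (*-monoˡ-≤ m (s≤s (/-monoʳ-≤ H {{prime⇒nonZero q′-prime}} Q≤q′)))
            (*-mono-≤ (+-monoʳ-≤ H q′≤X) (+-monoʳ-≤ H q≤X)))

        -- Here the lower bound q′ ≥ Q pays off: the rounding terms sum to Q (1 + H/Q) m ≤ 2 H m.
        QR≤ : Q * R ≤ 2 * (H * m) + Q * ((H + X) * (H + X))
        QR≤ = begin
          Q * R  ≡⟨ expand Q (H / Q) m ((H + X) * (H + X)) ⟩
          (Q + H / Q * Q) * m + Q * ((H + X) * (H + X))
            ≤⟨ +-monoˡ-≤ _ (*-monoˡ-≤ m (+-mono-≤ (≤-trans Q≤X X≤H) (m/n*n≤m H Q))) ⟩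
          (H + H) * m + Q * ((H + X) * (H + X))
            ≡⟨ cong (_+ Q * ((H + X) * (H + X))) (double H m) ⟩
          2 * (H * m) + Q * ((H + X) * (H + X)) ∎
          where
          open ≤-Reasoning
          expand : ∀ Q d m c → Q * (suc d * m + c) ≡ (Q + d * Q) * m + Q * c
          expand = solve-∀
          double : ∀ H m → (H + H) * m ≡ 2 * (H * m)
          double = solve-∀

        -- The constant is 6 = 1 + 2 + 2 + 1: the diagonal, the rounding terms, and the two lower
        -- terms of (H + X)², both reduced by Q X ≤ X² ≤ m.
        m*∑pairCount≤ : m * ∑ᴸ ps (λ q → ∑ᴸ ps λ q′ → pairCount q q′) ≤ (Q * H) * (Q * H) + 6 * (m * (Q * H))
        m*∑pairCount≤ = begin
          m * ∑ᴸ ps (λ q → ∑ᴸ ps λ q′ → pairCount q q′)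
            ≡⟨ *-∑ᴸ m ps _ ⟩
          ∑ᴸ ps (λ q → m * ∑ᴸ ps λ q′ → pairCount q q′)
            ≡⟨ ∑ᴸ-cong (All.universal (λ q → *-∑ᴸ m ps _) ps) ⟩
          ∑ᴸ ps (λ q → ∑ᴸ ps λ q′ → m * pairCount q q′)
            ≤⟨ ∑ᴸ-mono (All.tabulate λ {q} q∈ → ∑ᴸ-exceptOne q (λ q′ → m * pairCount q q′) unique
                 (λ { _ refl → let q-prime , q∤m , _ = All.lookup good q∈ in
                      *-monoʳ-≤ m (pairCount-diagonal q-prime q∤m H≤m) })
                 (λ q′∈ q′≢q → m*pairCount≤R q∈ q′∈ (≢-sym q′≢q))) ⟩
          ∑ᴸ ps (λ _ → m * H + Q * R)
            ≡⟨ ∑ᴸ-const ps _ ⟩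
          Q * (m * H + Q * R)
            ≤⟨ *-monoʳ-≤ Q (+-monoʳ-≤ (m * H) QR≤) ⟩
          Q * (m * H + (2 * (H * m) + Q * ((H + X) * (H + X))))
            ≡⟨ expand Q m H X ⟩
          (Q * H) * (Q * H) + (3 * (m * (Q * H)) + 2 * (Q * H * (Q * X)) + Q * X * (Q * X))
            ≤⟨ +-monoʳ-≤ ((Q * H) * (Q * H)) (+-mono-≤ (+-monoʳ-≤ (3 * (m * (Q * H)))
                 (*-monoʳ-≤ 2 (*-monoʳ-≤ (Q * H) QX≤m))) (*-mono-≤ (*-monoʳ-≤ Q X≤H) QX≤m)) ⟩
          (Q * H) * (Q * H) + (3 * (m * (Q * H)) + 2 * (Q * H * m) + Q * H * m)
            ≡⟨ cong ((Q * H) * (Q * H) +_) (collect m (Q * H)) ⟩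
          (Q * H) * (Q * H) + 6 * (m * (Q * H)) ∎
          where
          open ≤-Reasoning
          QX≤m : Q * X ≤ m
          QX≤m = ≤-trans (*-monoˡ-≤ X Q≤X) X²≤m
          expand : ∀ Q m H X → Q * (m * H + (2 * (H * m) + Q * ((H + X) * (H + X)))) ≡
            (Q * H) * (Q * H) + (3 * (m * (Q * H)) + 2 * (Q * H * (Q * X)) + Q * X * (Q * X))
          expand = solve-∀
          collect : ∀ m h → 3 * (m * h) + 2 * (h * m) + h * m ≡ 6 * (m * h)
          collect = solve-∀

        -- The terms N W² on the two sides cancel, leaving (m - N) W² ≤ 6 m N W; then N ≤ m, and one
        -- factor W is divided out.
        missed*QH≤6m² : (m ∸ card A) * (Q * H) ≤ 6 * (m * m)
        missed*QH≤6m² = *-cancelʳ-≤ _ _ W {{>-nonZero 1≤W}} (begin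
          (m ∸ N) * W * W              ≡⟨ *-assoc (m ∸ N) W W ⟩
          (m ∸ N) * (W * W)            ≡⟨ *-distribʳ-∸ (W * W) m N ⟩
          m * (W * W) ∸ N * (W * W)    ≤⟨ ∸-monoˡ-≤ (N * (W * W)) upper ⟩
          N * (W * W) + 6 * (m * m) * W ∸ N * (W * W)  ≡⟨ m+n∸m≡n (N * (W * W)) _ ⟩
          6 * (m * m) * W              ∎)
          where
          open ≤-Reasoning
          N W : ℕ
          N = card A
          W = Q * H
          1≤W : 1 ≤ W
          1≤W = *-mono-≤ ps≢[] (≤-trans ps≢[] (≤-trans Q≤X X≤H))
          swap : ∀ a b c → a * (b * c) ≡ b * (a * c)
          swap = solve-∀
          collect : ∀ m w → m * (6 * (m * w)) ≡ 6 * (m * m) * w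
          collect = solve-∀
          upper : m * (W * W) ≤ N * (W * W) + 6 * (m * m) * W
          upper = begin
            m * (W * W)                        ≤⟨ *-monoʳ-≤ m secondMoment ⟩
            m * (N * ∑ᴸ ps (λ q → ∑ᴸ ps λ q′ → pairCount q q′))  ≡⟨ swap m N _ ⟩
            N * (m * ∑ᴸ ps (λ q → ∑ᴸ ps λ q′ → pairCount q q′))  ≤⟨ *-monoʳ-≤ N m*∑pairCount≤ ⟩
            N * (W * W + 6 * (m * W))          ≡⟨ *-distribˡ-+ N (W * W) _ ⟩
            N * (W * W) + N * (6 * (m * W))    ≤⟨ +-monoʳ-≤ (N * (W * W)) (*-monoˡ-≤ (6 * (m * W)) (∣p∣≤n A)) ⟩
            N * (W * W) + m * (6 * (m * W))    ≡⟨ cong (N * (W * W) +_) (collect m W) ⟩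
            N * (W * W) + 6 * (m * m) * W      ∎

  module FullPeriod (m : ℕ) .{{_ : NonZero m}} (s : ℕ) where

    open PairCounts m s m

    -- The same second moment bound for a single prime, which has no off-diagonal terms.
    missed≡0 : (A : Subset m) → ∀ {q} → Prime q → q ∤ m →
      (∀ {j} → j < m → ρ (q , j) ∈ˢ A) → m ∸ card A ≡ 0
    missed≡0 A {q} q-prime q∤m covered = m≤n⇒m∸n≡0 (*-cancelʳ-≤ m (card A) m (begin
      m * m                      ≡⟨ cong₂ _*_ (+-identityʳ m) (+-identityʳ m) ⟨
      (1 * m) * (1 * m)          ≤⟨ Covering.secondMoment m s m A (q ∷ []) (λ { (here refl) → covered }) ⟩
      card A * (pairCount q q + 0 + 0)  ≡⟨ cong (card A *_) (trans (+-identityʳ _) (+-identityʳ _)) ⟩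
      card A * pairCount q q     ≤⟨ *-monoʳ-≤ (card A) (pairCount-diagonal q-prime q∤m ≤-refl) ⟩
      card A * m                 ∎))
      where open ≤-Reasoning

  -- The choice of primes

  length-filter-split : ∀ {A : Set} {p} {P : Pred A p} (P? : Decidable P) (xs : List A) →
    length xs ≡ length (filter P? xs) + length (filter (¬? ∘ P?) xs)
  length-filter-split P? [] = refl
  length-filter-split P? (x ∷ xs) with P? x
  ... | yes _ = cong suc (length-filter-split P? xs)
  ... | no  _ = trans (cong suc (length-filter-split P? xs)) (sym (+-suc _ _))

  -- By Euclid's lemma the remaining primes, being different from `p`, still divide the quotient of
  -- `n` by `p`.
  product-primes-∣ : ∀ {ps} n → Unique ps → All Prime ps → All (_∣ n) ps → product ps ∣ n
  product-primes-∣ n [] [] [] = 1∣ n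
  product-primes-∣ {p ∷ ps} n (p∉ ∷ unique) (p-prime ∷ primes) (divides k refl ∷ divs) =
    subst (p * product ps ∣_) (*-comm p k) (*-monoʳ-∣ p (product-primes-∣ k unique primes
      (All.zipWith (λ ((q-prime , q∣kp) , p≢q) →
        [ id , (λ q∣p → contradiction q∣p (distinct q-prime p≢q)) ]′ (euclidsLemma k p q-prime q∣kp))
        (All.zip (primes , divs) , p∉))))
    where
    distinct : ∀ {q} → Prime q → p ≢ q → q ∤ p
    distinct q-prime p≢q q∣p with prime⇒irreducible p-prime q∣p
    ... | inj₁ refl = ¬prime[1] q-prime
    ... | inj₂ q≡p = p≢q (sym q≡p)

  2^length≤product : ∀ {ps} → All Prime ps → 2 ^ length ps ≤ product ps
  2^length≤product [] = ≤-refl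
  2^length≤product (p-prime ∷ primes) =
    *-mono-≤ (nonTrivial⇒n>1 _ {{prime⇒nonTrivial p-prime}}) (2^length≤product primes)

  2^-cancel-≤ : ∀ {a b} → 2 ^ a ≤ 2 ^ b → a ≤ b
  2^-cancel-≤ h = ≮⇒≥ λ b<a → <⇒≱ (^-monoʳ-< 2 ≤-refl b<a) h

  -- Guarantees room to discard the prime divisors of `m`. The inequality first holds at l = 10,
  -- where it reads 972 ≤ 1024; this fixes the threshold for `m`.
  8[1+l]²+4≤2^l : ∀ i → 8 * (suc (10 + i) * suc (10 + i)) + 4 ≤ 2 ^ (10 + i)
  8[1+l]²+4≤2^l zero = m≤m+n 972 52
  8[1+l]²+4≤2^l (suc i) = begin
    8 * (suc (suc (10 + i)) * suc (suc (10 + i))) + 4    ≤⟨ m≤m+n _ _ ⟩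
    8 * (suc (suc (10 + i)) * suc (suc (10 + i))) + 4 + (8 * (i * i) + 160 * i + 788)  ≡⟨ expand i ⟩
    2 * (8 * (suc (10 + i) * suc (10 + i)) + 4)          ≤⟨ *-monoʳ-≤ 2 (8[1+l]²+4≤2^l i) ⟩
    2 * 2 ^ (10 + i)                                     ∎
    where
    open ≤-Reasoning
    expand : ∀ i → 8 * (suc (suc (10 + i)) * suc (suc (10 + i))) + 4 + (8 * (i * i) + 160 * i + 788)
           ≡ 2 * (8 * (suc (10 + i) * suc (10 + i)) + 4)
    expand = solve-∀

  module PrimeSelection (m X l : ℕ) .{{_ : NonZero m}} (10≤l : 10 ≤ l) (2ˡ≤X : 2 ^ l ≤ X) (X<2ˡ⁺¹ : X < 2 ^ suc l)
           (m<[1+X]² : m < suc X * suc X) where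

    private
      T Q π : ℕ
      T = suc l
      Q = X / (8 * T)
      π = length (primesUpTo X)

    8T²+4≤X : 8 * (T * T) + 4 ≤ X
    8T²+4≤X = ≤-trans (subst (λ l → 8 * (suc l * suc l) + 4 ≤ 2 ^ l) (m+[n∸m]≡n 10≤l)
      (8[1+l]²+4≤2^l (l ∸ 10))) 2ˡ≤X

    1≤Q : 1 ≤ Q
    1≤Q = m≥n⇒m/n>0 (≤-trans (≤-trans (*-monoʳ-≤ 8 (m≤m*n T T)) (m≤m+n _ 4)) 8T²+4≤X)

    -- 32 = 8 · 2 · 2: rounding down in `Q` costs a factor 2 because `Q ≥ 1`, and replacing T = l +
    -- 1 by `l` costs another.
    X≤32Ql : X ≤ 32 * (Q * l)
    X≤32Ql = begin
      X                          ≡⟨ m≡m%n+[m/n]*n X (8 * T) ⟩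
      X % (8 * T) + Q * (8 * T)  ≤⟨ +-monoˡ-≤ (Q * (8 * T)) (≤-trans (m%n≤n X (8 * T))
                                      (m≤n*m (8 * T) Q {{>-nonZero 1≤Q}})) ⟩
      Q * (8 * T) + Q * (8 * T)  ≡⟨ collect Q T ⟩
      16 * (Q * T)               ≤⟨ *-monoʳ-≤ 16 (*-monoʳ-≤ Q (+-monoˡ-≤ l (≤-trans (s≤s z≤n) 10≤l))) ⟩
      16 * (Q * (l + l))         ≡⟨ double Q l ⟩
      32 * (Q * l)               ∎
      where
      open ≤-Reasoning
      collect : ∀ Q T → Q * (8 * T) + Q * (8 * T) ≡ 16 * (Q * T)
      collect = solve-∀
      double : ∀ Q l → 16 * (Q * (l + l)) ≡ 32 * (Q * l)
      double = solve-∀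

    -- Chebyshev's bound with k = ⌊(X - 1)/2⌋: 2^k ≤ X^π ≤ 2^(T π), hence k ≤ T π.
    X≤2πT+2 : X ≤ 2 * (T * π) + 2
    X≤2πT+2 = go X refl
      where
      open ≤-Reasoning
      go : ∀ Y → Y ≡ X → Y ≤ 2 * (T * π) + 2
      go zero _ = z≤n
      go (suc Y) refl = begin
        suc Y                          ≡⟨ cong suc (m≡m%n+[m/n]*n Y 2) ⟩
        suc (Y % 2) + k * 2            ≤⟨ +-mono-≤ (m%n<n Y 2) (*-monoˡ-≤ 2 k≤Tπ) ⟩
        2 + T * π * 2                  ≡⟨ trans (+-comm 2 _) (cong (_+ 2) (*-comm (T * π) 2)) ⟩
        2 * (T * π) + 2                ∎
        where
        k = Y / 2
        2k≤Y : k + k ≤ Y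
        2k≤Y = ≤-trans (≤-reflexive (trans (cong (k +_) (sym (+-identityʳ k))) (*-comm 2 k))) (m/n*n≤m Y 2)
        k≤Tπ : k ≤ T * π
        k≤Tπ = 2^-cancel-≤ (begin
          2 ^ k          ≤⟨ 2^k≤n^π k X (s≤s 2k≤Y) ⟩
          X ^ π          ≤⟨ ^-monoˡ-≤ π (<⇒≤ X<2ˡ⁺¹) ⟩
          (2 ^ T) ^ π    ≡⟨ ^-*-assoc 2 T π ⟩
          2 ^ (T * π)    ∎)

    -- The doubled Chebyshev bound 2 X ≤ 4 T π + 4 is spent in two halves: one `X` covers 2 Q primes
    -- (at most Q small ones to discard, Q to keep), the other the at most 2 T prime divisors of
    -- `m`. This dictates the 8 in `Q`.
    2Q+2T≤π : Q + Q + (T + T) ≤ π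
    2Q+2T≤π = *-cancelˡ-≤ (4 * T) (+-cancelʳ-≤ 4 _ _ (begin
      4 * T * (Q + Q + (T + T)) + 4    ≡⟨ expand T Q ⟩
      Q * (8 * T) + (8 * (T * T) + 4)  ≤⟨ +-mono-≤ (m/n*n≤m X (8 * T)) 8T²+4≤X ⟩
      X + X                            ≤⟨ +-mono-≤ X≤2πT+2 X≤2πT+2 ⟩
      2 * (T * π) + 2 + (2 * (T * π) + 2)  ≡⟨ collect T π ⟩
      4 * T * π + 4                    ∎))
      where
      open ≤-Reasoning
      expand : ∀ T Q → 4 * T * (Q + Q + (T + T)) + 4 ≡ Q * (8 * T) + (8 * (T * T) + 4)
      expand = solve-∀
      collect : ∀ T π → 2 * (T * π) + 2 + (2 * (T * π) + 2) ≡ 4 * T * π + 4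
      collect = solve-∀

    private
      primes divisors nondivisors small large : List ℕ
      primes = primesUpTo X
      divisors = filter (_∣? m) primes
      nondivisors = filter (¬? ∘ (_∣? m)) primes
      small = filter (_<? Q) nondivisors
      large = filter (¬? ∘ (_<? Q)) nondivisors

    primes-unique : Unique primes
    primes-unique = filter⁺ prime? (upTo⁺ (suc X))

    -- The product of the distinct primes dividing `m` divides `m`; it is at least 2 to their number
    -- and at most (X + 1)² ≤ 4^T.
    divisors-length : length divisors ≤ T + T
    divisors-length = 2^-cancel-≤ (begin
      2 ^ length divisors   ≤⟨ 2^length≤product divisors-prime ⟩
      product divisors      ≤⟨ ∣⇒≤ (product-primes-∣ m (filter⁺ (_∣? m) primes-unique) divisors-prime
                                 (all-filter (_∣? m) primes)) ⟩
      m                     ≤⟨ <⇒≤ m<[1+X]² ⟩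
      suc X * suc X         ≤⟨ *-mono-≤ X<2ˡ⁺¹ X<2ˡ⁺¹ ⟩
      2 ^ T * 2 ^ T         ≡⟨ ^-distribˡ-+-* 2 T T ⟨
      2 ^ (T + T)           ∎)
      where
      open ≤-Reasoning
      divisors-prime : All Prime divisors
      divisors-prime = all-filter⁺ (_∣? m) (all-filter prime? (upTo (suc X)))

    nondivisors-unique : Unique nondivisors
    nondivisors-unique = filter⁺ (¬? ∘ (_∣? m)) primes-unique

    small-length : length small ≤ Q
    small-length = length≤ (filter⁺ (_<? Q) nondivisors-unique)
      (all-filter (_<? Q) nondivisors) id id (λ _ _ → id)

    Q≤large : Q ≤ length large
    Q≤large = +-cancelˡ-≤ (Q + (T + T)) _ _ (begin
      Q + (T + T) + Q      ≡⟨ swap Q (T + T) ⟩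
      Q + Q + (T + T)      ≤⟨ 2Q+2T≤π ⟩
      length primes        ≡⟨ length-filter-split (_∣? m) primes ⟩
      length divisors + length nondivisors
        ≡⟨ cong (length divisors +_) (length-filter-split (_<? Q) nondivisors) ⟩
      length divisors + (length small + length large)
        ≤⟨ +-mono-≤ divisors-length (+-monoˡ-≤ (length large) small-length) ⟩
      (T + T) + (Q + length large)  ≡⟨ regroup (T + T) Q (length large) ⟩
      Q + (T + T) + length large    ∎)
      where
      open ≤-Reasoning
      swap : ∀ Q T → Q + T + Q ≡ Q + Q + T
      swap = solve-∀
      regroup : ∀ T Q L → T + (Q + L) ≡ Q + T + L
      regroup = solve-∀

    -- Discarding the primes below Q keeps ∑ 1/q at most 1, and costs at most Q primes.
    manyPrimes : ∃ λ ps → Unique ps × 1 ≤ length ps × length ps ≤ X × X ≤ 32 * (length ps * l) ×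
      All (λ q → Prime q × q ∤ m × length ps ≤ q × q ≤ X) ps
    manyPrimes = ps , take⁺ Q (filter⁺ (¬? ∘ (_<? Q)) nondivisors-unique)
      , ≤-trans 1≤Q (≤-reflexive (sym length≡Q))
      , ≤-trans (≤-reflexive length≡Q) (m/n≤m X (8 * T))
      , subst (λ Q → X ≤ 32 * (Q * l)) (sym length≡Q) X≤32Ql
      , all-take⁺ Q (All.zipWith (λ ((p , d) , (≮Q , ≤X)) → p , d , ≤-trans (≤-reflexive length≡Q) (≮⇒≥ ≮Q) , ≤X)
          ( All.zip (large⁺ (nondivisors⁺ (all-filter prime? (upTo (suc X)))) , large⁺ (all-filter (¬? ∘ (_∣? m)) primes))
          , All.zip (all-filter (¬? ∘ (_<? Q)) nondivisors , large⁺ (nondivisors⁺ (all-filter⁺ prime? upTo-bound)))))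
      where
      -- Cut to exactly `Q` primes, so that `length ps ≤ q` is the same as `Q ≤ q`.
      ps = take Q large
      length≡Q : length ps ≡ Q
      length≡Q = trans (length-take Q large) (m≤n⇒m⊓n≡m Q≤large)
      large⁺ : ∀ {P : Pred ℕ _} → All P nondivisors → All P large
      large⁺ = all-filter⁺ (¬? ∘ (_<? Q))
      nondivisors⁺ : ∀ {P : Pred ℕ _} → All P primes → All P nondivisors
      nondivisors⁺ = all-filter⁺ (¬? ∘ (_∣? m))
      upTo-bound : All (_≤ X) (upTo (suc X))
      upTo-bound = All.tabulate (s≤s⁻¹ ∘ ∈-upTo⁻)

  -- Assembly of the bound in natural numbers

  m≤isqrt : ∀ {a n} → a * a ≤ n → a ≤ isqrt n
  m≤isqrt {a} {n} a²≤n = ≮⇒≥ λ √n<a → <⇒≱ (isqrt-upper n) (≤-trans (*-mono-≤ √n<a √n<a) a²≤n)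

  -- Supplies the integer `l` that replaces log m: the lower bracket yields l ≤ log m, the upper one
  -- keeps `l` of the right order for the prime count.
  log₂√ : ∀ k m → 2 ^ k * 2 ^ k ≤ m →
    ∃ λ l → k ≤ l × 2 ^ l ≤ isqrt m × isqrt m < 2 ^ suc l
  log₂√ k m 4ᵏ≤m with m≤isqrt {2 ^ k} 4ᵏ≤m
  ... | 2ᵏ≤√m with ^-bracket 2 (isqrt m) ≤-refl (≤-trans (m^n>0 2 k) 2ᵏ≤√m)
  ...   | l , 2ˡ≤ , <2ˡ⁺¹ = l , s≤s⁻¹ (≰⇒> λ 1+l≤k → <⇒≱ <2ˡ⁺¹ (≤-trans (^-monoʳ-≤ 2 1+l≤k) 2ᵏ≤√m))
        , 2ˡ≤ , <2ˡ⁺¹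

  -- m ≤ a X² ≤ a b X Q l trades the product Q X l for `m` up to the factor a b; one `m` then
  -- cancels.
  combineBounds : ∀ a b c {m M D X Q l} .{{_ : NonZero m}} → m ≤ a * (X * X) → X ≤ b * (Q * l) →
    M * (Q * (D * X * l)) ≤ c * (m * m) → M * D ≤ a * b * c * m
  combineBounds a b c {m} {M} {D} {X} {Q} {l} m≤aX² X≤bQl h = *-cancelʳ-≤ _ _ m (begin
    M * D * m                          ≤⟨ *-monoʳ-≤ (M * D) m≤aX² ⟩
    M * D * (a * (X * X))              ≤⟨ *-monoʳ-≤ (M * D) (*-monoʳ-≤ a (*-monoʳ-≤ X X≤bQl)) ⟩
    M * D * (a * (X * (b * (Q * l))))  ≡⟨ collect a b M D X Q l ⟩
    a * b * (M * (Q * (D * X * l)))    ≤⟨ *-monoʳ-≤ (a * b) h ⟩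
    a * b * (c * (m * m))              ≡⟨ regroup (a * b) c m ⟩
    a * b * c * m * m                  ∎)
    where
    open ≤-Reasoning
    collect : ∀ a b M D X Q l → M * D * (a * (X * (b * (Q * l)))) ≡ a * b * (M * (Q * (D * X * l)))
    collect = solve-∀
    regroup : ∀ d c m → d * (c * (m * m)) ≡ d * c * m * m
    regroup = solve-∀

  module _ (m : ℕ) .{{_ : NonZero m}} (s D l : ℕ) (1≤D : 1 ≤ D) (10≤l : 10 ≤ l)
           (2ˡ≤√m : 2 ^ l ≤ isqrt m) (√m<2ˡ⁺¹ : isqrt m < 2 ^ suc l) where

    -- The factors are 4 from m ≤ (X + 1)² ≤ 4 X², 32 from the prime selection and 6 from the second
    -- moment. `ρ` is the same map whatever `H` is, so one covering hypothesis serves both a full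
    -- period and a short interval.
    missed*D≤ : (A : Subset m) →
      (∀ {q j} → Prime q → q ≤ isqrt m → j < D * isqrt m * l → PairCounts.ρ m s 0 (q , j) ∈ˢ A) →
      (m ∸ card A) * D ≤ 4 * 32 * 6 * m
    missed*D≤ A covered =
      let ps , selected = PrimeSelection.manyPrimes m (isqrt m) l 10≤l 2ˡ≤√m √m<2ˡ⁺¹ (isqrt-upper m)
      in cases ps selected (m ≤? H)
      where
      open ≤-Reasoning
      X H : ℕ
      X = isqrt m
      H = D * X * l
      1≤X : 1 ≤ X
      1≤X = ≤-trans (m^n>0 2 l) 2ˡ≤√m
      m≤4X² : m ≤ 4 * (X * X)
      m≤4X² = begin
        m                  ≤⟨ <⇒≤ (isqrt-upper m) ⟩
        suc X * suc X      ≤⟨ *-mono-≤ (+-monoˡ-≤ X 1≤X) (+-monoˡ-≤ X 1≤X) ⟩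
        (X + X) * (X + X)  ≡⟨ square X ⟩
        4 * (X * X)        ∎
        where
        square : ∀ X → (X + X) * (X + X) ≡ 4 * (X * X)
        square = solve-∀
      X≤H : X ≤ H
      X≤H = ≤-trans (m≤n*m X D {{>-nonZero 1≤D}}) (m≤m*n (D * X) l {{>-nonZero (≤-trans (s≤s z≤n) 10≤l)}})
      cases : ∀ ps → Unique ps × 1 ≤ length ps × length ps ≤ X × X ≤ 32 * (length ps * l) ×
          All (λ q → Prime q × q ∤ m × length ps ≤ q × q ≤ X) ps →
        Dec (m ≤ H) → (m ∸ card A) * D ≤ 4 * 32 * 6 * m
      -- The interval contains a full period, on which multiplication by one `q` prime to `m` is
      -- already onto.
      cases (q ∷ _) (_ , _ , _ , _ , (q-prime , q∤m , _ , q≤X) ∷ _) (yes m≤H) =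
        ≤-trans (≤-reflexive (cong (_* D) (FullPeriod.missed≡0 m s A q-prime q∤m
          λ j<m → covered q-prime q≤X (<-≤-trans j<m m≤H)))) z≤n
      cases ps (unique , ps≢[] , Q≤X , X≤32Ql , good) (no m≰H) = combineBounds 4 32 6 {M = m ∸ card A} {D} {X} {length ps} {l} m≤4X² X≤32Ql
        (Covering.missed*QH≤6m² m s H A ps
          (λ q∈ j<H → let p , _ , _ , q≤X = All.lookup good q∈ in covered p q≤X j<H)
          unique ps≢[] good Q≤X (isqrt-lower m) X≤H (<⇒≤ (≰⇒> m≰H)))

-- Comparing real quantities with integers

module RealEstimates where

  open CoveringBound using (m≤isqrt)
  open RationalLemmas
  open RecipLemmas
  open LogLemmas
  open ReciprocalLemmas
  import Data.Nat.Base as ℕ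
  open import Data.Nat.Base using (ℕ; zero; suc; NonZero)
  import Data.Nat.Properties as ℕ
  import Data.Nat.DivMod as ℕ
  open import Data.Integer.Base as ℤ using (ℤ; +_; -[1+_])
  import Data.Integer.Properties as ℤ
  open import Data.Integer.DivMod using (_%ℕ_; _/ℕ_; a≡a%ℕn+[a/ℕn]*n; n%ℕd<d)
  import Data.Integer.Tactic.RingSolver as ℤ-Solver
  import Data.Rational.Unnormalised.Base as ℚᵘ
  import Data.Rational.Unnormalised.Properties as ℚᵘ
  open import Data.Rational.Base hiding (NonZero)
  open import Data.Rational.Properties
  open import Data.Rational.Literals using (fromℤ)
  open import Data.Rational.Solver using (module +-*-Solver)
  open +-*-Solver
  open import Data.List.Properties using (length-filter; length-applyUpTo)
  open import Data.Nat.Coprimality using (coprime?)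
  open import Data.List.Base using (applyUpTo)
  open import Data.Product.Base using (∃; _×_; _,_; proj₁; proj₂)
  open import Relation.Binary.PropositionalEquality hiding (J)

  fromℤ-+ : ∀ i j → fromℤ (i ℤ.+ j) ≡ fromℤ i + fromℤ j
  fromℤ-+ i j = toℚᵘ-injective (ℚᵘ.≃-trans
    (ℚᵘ.*≡* (cong (ℤ._* + 1) (sym (cong₂ ℤ._+_ (ℤ.*-identityʳ i) (ℤ.*-identityʳ j)))))
    (ℚᵘ.≃-sym (toℚᵘ-homo-+ (fromℤ i) (fromℤ j))))

  fromℕ-cancel-≤ : ∀ {a b} → fromℕ a ≤ fromℕ b → a ℕ.≤ b
  fromℕ-cancel-≤ {a} {b} (*≤* h) = ℤ.drop‿+≤+ (subst₂ ℤ._≤_ (ℤ.*-identityʳ (+ a)) (ℤ.*-identityʳ (+ b)) h)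

  0≤fromℕ : ∀ n → 0ℚ ≤ fromℕ n
  0≤fromℕ n = fromℕ-mono {0} {n} ℕ.z≤n

  floor-bounds : ∀ q → 0ℚ ≤ q → ∃ λ E → fromℕ E ≤ q × q ≤ fromℕ (suc E)
  floor-bounds (mkℚ -[1+ _ ] _ _) (*≤* ())
  floor-bounds q@(mkℚ (+ p) d-1 _) _ = E
    , *-cancelʳ-≤-pos (fromℕ d) (≤-trans (≤-reflexive (sym (fromℕ-* E d)))
        (≤-trans (fromℕ-mono (ℕ.m/n*n≤m p d)) (≤-reflexive (sym (↥-↧ q)))))
    , *-cancelʳ-≤-pos (fromℕ d) (≤-trans (≤-reflexive (↥-↧ q))
        (≤-trans (fromℕ-mono (ℕ.<⇒≤ p<)) (≤-reflexive (fromℕ-* (suc E) d))))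
    where
    d E : ℕ
    d = suc d-1
    E = p ℕ./ d
    p< : p ℕ.< suc E ℕ.* d
    p< = ℕ.≤-<-trans (ℕ.≤-reflexive (ℕ.m≡m%n+[m/n]*n p d)) (ℕ.+-monoˡ-< (E ℕ.* d) (ℕ.m%n<n p d))

  -- The approximation rounds down to a multiple of 1/(d k), and `a` is itself such a multiple, so
  -- the comparison loses nothing at any stage.
  ≤-sqrtApprox : ∀ a n {q} → fromℕ a * fromℕ a ≤ q → fromℕ a ≤ sqrtApprox n q
  ≤-sqrtApprox a n {q} a²≤q = *-cancelʳ-≤-pos D {{positive 0<D}} (begin
    fromℕ a * D            ≡⟨ fromℕ-* a (d ℕ.* k) ⟨
    fromℕ (a ℕ.* (d ℕ.* k))  ≤⟨ fromℕ-mono (m≤isqrt (fromℕ-cancel-≤ square≤)) ⟩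
    fromℕ t                ≡⟨ sD ⟨
    s * D                  ∎)
    where
    open SqrtLemmas.SqrtApprox n q (≤-trans (*-nonNeg (0≤fromℕ a) (0≤fromℕ a)) a²≤q)
      using (p; d; k; t; s; D; sD; 0<D; 0<DD; qDD)
    open ≤-Reasoning
    square≤ : fromℕ (a ℕ.* (d ℕ.* k) ℕ.* (a ℕ.* (d ℕ.* k))) ≤ fromℕ (p ℕ.* d ℕ.* (k ℕ.* k))
    square≤ = begin
      fromℕ (a ℕ.* (d ℕ.* k) ℕ.* (a ℕ.* (d ℕ.* k)))    ≡⟨ fromℕ-* (a ℕ.* (d ℕ.* k)) (a ℕ.* (d ℕ.* k)) ⟩
      fromℕ (a ℕ.* (d ℕ.* k)) * fromℕ (a ℕ.* (d ℕ.* k))  ≡⟨ cong₂ _*_ (fromℕ-* a (d ℕ.* k)) (fromℕ-* a (d ℕ.* k)) ⟩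
      fromℕ a * D * (fromℕ a * D)                    ≡⟨ solve 2 (λ a D → a :* D :* (a :* D) := a :* a :* (D :* D)) refl (fromℕ a) D ⟩
      fromℕ a * fromℕ a * (D * D)                    ≤⟨ *-monoʳ-≤-nonNeg (D * D) {{nonNegative (<⇒≤ 0<DD)}} a²≤q ⟩
      q * (D * D)                                    ≡⟨ qDD ⟩
      fromℕ (p ℕ.* d ℕ.* (k ℕ.* k))                  ∎

  ≤-√ : ∀ a x n → fromℕ a * fromℕ a ≤ seq x n → fromℕ a ≤ seq (√ x) n
  ≤-√ a x n h = ≤-sqrtApprox a n (≤-trans h (p≤p⊔q (seq x n) 0ℚ))

  1≤m/φ[m] : ∀ m → .{{_ : NonZero m}} → 1ℚ ≤ m/φ[m] m
  1≤m/φ[m] m = *-cancelʳ-≤-pos (fromℕ (φ m)) {{positive 0<φ}} (begin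
    1ℚ * fromℕ (φ m)        ≡⟨ *-identityˡ (fromℕ (φ m)) ⟩
    fromℕ (φ m)             ≤⟨ fromℕ-mono φ≤m ⟩
    fromℕ m                 ≡⟨ /-* (+ m) (φ m) {{φ-nonZero m}} ⟨
    m/φ[m] m * fromℕ (φ m)  ∎)
    where
    open ≤-Reasoning
    φ≤m : φ m ℕ.≤ m
    φ≤m = ℕ.≤-trans (length-filter (λ k → coprime? k m) (applyUpTo suc m)) (ℕ.≤-reflexive (length-applyUpTo suc m))
    0<φ : 0ℚ < fromℕ (φ m)
    0<φ = <-≤-trans (positive⁻¹ 1ℚ) (fromℕ-mono (ℕ.>-nonZero⁻¹ (φ m) {{φ-nonZero m}}))

  logSum-mono : ∀ {m n} k → m ℕ.≤ n → logSum m k ≤ logSum n k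
  logSum-mono {m} {n} k m≤n = begin
    ∑ f a                                      ≤⟨ p≤p+q tail-nonNeg ⟩
    ∑ f a + ∑ (λ i → f (a ℕ.+ i)) (b ℕ.∸ a)    ≡⟨ ∑-split f a (b ℕ.∸ a) ⟨
    ∑ f (a ℕ.+ (b ℕ.∸ a))                      ≡⟨ cong (∑ f) (ℕ.m+[n∸m]≡n (ℕ.*-monoˡ-≤ k (ℕ.∸-monoˡ-≤ 1 m≤n))) ⟩
    ∑ f b                                      ∎
    where
    open ≤-Reasoning
    f : ℕ → ℚ
    f i = recip (k ℕ.+ i)
    a b : ℕ
    a = (m ℕ.∸ 1) ℕ.* k
    b = (n ℕ.∸ 1) ℕ.* k
    tail-nonNeg : 0ℚ ≤ ∑ (λ i → f (a ℕ.+ i)) (b ℕ.∸ a)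
    tail-nonNeg = ≤-trans (≤-reflexive (sym (trans (∑-const 0ℚ (b ℕ.∸ a)) (*-zeroˡ (fromℕ (b ℕ.∸ a))))))
      (∑-mono (b ℕ.∸ a) (λ i _ → <⇒≤ (recip-pos (k ℕ.+ (a ℕ.+ i)))))

  -- The last mk of the (2m-1)k terms are each at least 1/(2mk).
  logSum-double : ∀ m k → 1 ℕ.≤ m → logSum m (suc k) + ½ ≤ logSum (m ℕ.+ m) (suc k)
  logSum-double (suc m) k _ = begin
    ∑ f a + ½                              ≡⟨ cong (λ u → ∑ f a + u) r*J≡½ ⟨
    ∑ f a + r * fromℕ J                    ≡⟨ cong (λ u → ∑ f a + u) (∑-const r J) ⟨
    ∑ f a + ∑ (λ _ → r) J                  ≤⟨ +-monoʳ-≤ (∑ f a) (∑-mono J (λ i i<J → recip-anti (index i i<J))) ⟩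
    ∑ f a + ∑ (λ i → f (a ℕ.+ i)) J        ≡⟨ ∑-split f a J ⟨
    ∑ f (a ℕ.+ J)                          ≡⟨ cong (∑ f) (ℕ.*-distribʳ-+ (suc k) m (suc m)) ⟨
    ∑ f ((m ℕ.+ suc m) ℕ.* suc k)          ∎
    where
    open ≤-Reasoning
    f : ℕ → ℚ
    f i = recip (suc k ℕ.+ i)
    a j J : ℕ
    a = m ℕ.* suc k
    j = k ℕ.+ a
    J = suc m ℕ.* suc k
    r : ℚ
    r = recip (J ℕ.+ j)
    index : ∀ i → i ℕ.< J → suc k ℕ.+ (a ℕ.+ i) ℕ.≤ J ℕ.+ j
    index i i<J = ℕ.≤-trans (ℕ.≤-reflexive (sym (ℕ.+-assoc (suc k) a i))) (ℕ.+-monoʳ-≤ J (ℕ.s≤s⁻¹ i<J))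
    r*J≡½ : r * fromℕ J ≡ ½
    r*J≡½ = begin-equality
      r * fromℕ J                      ≡⟨ halves (r * fromℕ J) ⟨
      r * fromℕ J * ½ + r * fromℕ J * ½  ≡⟨ solve 3 (λ r J h → r :* J :* h :+ r :* J :* h := r :* (J :+ J) :* h) refl r (fromℕ J) ½ ⟩
      r * (fromℕ J + fromℕ J) * ½      ≡⟨ cong (λ u → r * u * ½) (fromℕ-+ J J) ⟨
      r * fromℕ (J ℕ.+ J) * ½          ≡⟨ cong (λ u → r * fromℕ u * ½) (ℕ.+-suc J j) ⟩
      r * fromℕ (suc (J ℕ.+ j)) * ½    ≡⟨ cong (_* ½) (recip-* (J ℕ.+ j)) ⟩
      1ℚ * ½                           ≡⟨ *-identityˡ ½ ⟩
      ½                                ∎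

  logSum-2^ : ∀ j k → fromℕ j * ½ ≤ logSum (2 ℕ.^ j) (suc k)
  logSum-2^ zero    k = ≤-reflexive (*-zeroˡ ½)
  logSum-2^ (suc j) k = begin
    fromℕ (suc j) * ½                    ≡⟨ cong (λ i → fromℕ i * ½) (ℕ.+-comm 1 j) ⟩
    fromℕ (j ℕ.+ 1) * ½                  ≡⟨ cong (_* ½) (fromℕ-+ j 1) ⟩
    (fromℕ j + 1ℚ) * ½                   ≡⟨ *-distribʳ-+ ½ (fromℕ j) 1ℚ ⟩
    fromℕ j * ½ + 1ℚ * ½                 ≤⟨ +-mono-≤ (logSum-2^ j k) (≤-reflexive (*-identityˡ ½)) ⟩
    logSum (2 ℕ.^ j) (suc k) + ½         ≤⟨ logSum-double (2 ℕ.^ j) k (ℕ.m^n>0 2 j) ⟩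
    logSum (2 ℕ.^ j ℕ.+ 2 ℕ.^ j) (suc k) ≡⟨ cong (λ u → logSum (2 ℕ.^ j ℕ.+ u) (suc k)) (ℕ.+-identityʳ (2 ℕ.^ j)) ⟨
    logSum (2 ℕ.^ suc j) (suc k)         ∎
    where open ≤-Reasoning

  -- 4^l ≤ m provides 2 l doublings, each worth at least 1/2 in every Riemann sum; so the bound
  -- holds at every index.
  ≤-log : ∀ m l → .{{_ : NonZero m}} → 2 ℕ.^ l ℕ.* 2 ℕ.^ l ℕ.≤ m → ∀ n → fromℕ l ≤ seq (log m) n
  ≤-log m l 4ˡ≤m n = begin
    fromℕ l                      ≡⟨ halves (fromℕ l) ⟨
    fromℕ l * ½ + fromℕ l * ½    ≡⟨ *-distribʳ-+ ½ (fromℕ l) (fromℕ l) ⟨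
    (fromℕ l + fromℕ l) * ½      ≡⟨ cong (_* ½) (fromℕ-+ l l) ⟨
    fromℕ (l ℕ.+ l) * ½          ≤⟨ logSum-2^ (l ℕ.+ l) n ⟩
    logSum (2 ℕ.^ (l ℕ.+ l)) (suc n)  ≤⟨ logSum-mono (suc n) (ℕ.≤-trans (ℕ.≤-reflexive (ℕ.^-distribˡ-+-* 2 l l)) 4ˡ≤m) ⟩
    logSum m (suc n)             ∎
    where open ≤-Reasoning

  -- A real has no computable floor, so `D` is read off one term a beyond which the sequence varies
  -- by at most 1. There a ≥ 3 - 1 = 2, and D = ⌊a - 2⌋ + 1 satisfies D ≤ a - 1 and a + 1 ≤ D + 3 ≤
  -- 4 D.
  eventualBounds : ∀ x → ℕ→ℝ 3 ≤ʳ x → ∃ λ D → 1 ℕ.≤ D × ∃ λ N → ∀ n → N ℕ.≤ n →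
    fromℕ D ≤ seq x n × seq x n ≤ fromℕ (4 ℕ.* D)
  eventualBounds x 3≤x = suc E , ℕ.s≤s ℕ.z≤n , N , λ n N≤n →
    let h = Cauchy n N (⊔ʳ N≤n) (⊔ʳ ℕ.≤-refl)
        h′ = Cauchy N n (⊔ʳ ℕ.≤-refl) (⊔ʳ N≤n)
    in lower (seq x n) (∣p-q∣≤⇒≤ h′) , upper (seq x n) (∣p-q∣≤⇒≤ h)
    where
    open ≤-Reasoning
    N₁ = proj₁ (3≤x 1ℚ (positive⁻¹ 1ℚ))
    N₂ = proj₁ (cauchy x 1ℚ (positive⁻¹ 1ℚ))
    Cauchy = proj₂ (cauchy x 1ℚ (positive⁻¹ 1ℚ))
    N : ℕ
    N = N₁ ℕ.⊔ N₂
    ⊔ʳ : ∀ {n} → N ℕ.≤ n → N₂ ℕ.≤ n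
    ⊔ʳ = ℕ.≤-trans (ℕ.m≤n⊔m N₁ N₂)
    a : ℚ
    a = seq x N
    0≤a-2 : 0ℚ ≤ a - fromℕ 2
    0≤a-2 = begin
      0ℚ                          ≡⟨⟩
      fromℕ 3 - fromℕ 3           ≤⟨ +-monoˡ-≤ (- fromℕ 3) (proj₂ (3≤x 1ℚ (positive⁻¹ 1ℚ)) N (ℕ.m≤m⊔n N₁ N₂)) ⟩
      (a + 1ℚ) - fromℕ 3          ≡⟨ +-assoc a 1ℚ (- fromℕ 3) ⟩
      a - fromℕ 2                 ∎
    E : ℕ
    E = proj₁ (floor-bounds (a - fromℕ 2) 0≤a-2)
    E≤ : fromℕ E ≤ a - fromℕ 2
    E≤ = proj₁ (proj₂ (floor-bounds (a - fromℕ 2) 0≤a-2))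
    ≤1+E : a - fromℕ 2 ≤ fromℕ (suc E)
    ≤1+E = proj₂ (proj₂ (floor-bounds (a - fromℕ 2) 0≤a-2))
    lower : ∀ b → a ≤ b + 1ℚ → fromℕ (suc E) ≤ b
    lower b a≤b+1 = begin
      fromℕ (suc E)           ≡⟨ fromℕ-+ 1 E ⟩
      1ℚ + fromℕ E            ≤⟨ +-monoʳ-≤ 1ℚ E≤ ⟩
      1ℚ + (a - fromℕ 2)      ≤⟨ +-monoʳ-≤ 1ℚ (+-monoˡ-≤ (- fromℕ 2) a≤b+1) ⟩
      1ℚ + ((b + 1ℚ) - fromℕ 2)  ≡⟨ solve 1 (λ b → con 1ℚ :+ ((b :+ con 1ℚ) :- con (fromℕ 2)) := b) refl b ⟩
      b                       ∎
    upper : ∀ b → b ≤ a + 1ℚ → b ≤ fromℕ (4 ℕ.* suc E)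
    upper b b≤a+1 = begin
      b                             ≤⟨ b≤a+1 ⟩
      a + 1ℚ                        ≡⟨ solve 1 (λ a → a :+ con 1ℚ := (a :- con (fromℕ 2)) :+ con (fromℕ 3)) refl a ⟩
      (a - fromℕ 2) + fromℕ 3       ≤⟨ +-monoˡ-≤ (fromℕ 3) ≤1+E ⟩
      fromℕ (suc E) + fromℕ 3       ≡⟨ fromℕ-+ (suc E) 3 ⟨
      fromℕ (suc E ℕ.+ 3)           ≤⟨ fromℕ-mono (ℕ.+-monoʳ-≤ (suc E) (ℕ.m≤n*m 3 (suc E))) ⟩
      fromℕ (suc E ℕ.+ suc E ℕ.* 3)   ≡⟨ cong (λ u → fromℕ (suc E ℕ.+ u)) (ℕ.*-comm (suc E) 3) ⟩
      fromℕ (4 ℕ.* suc E)           ∎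

  -- The two quotients differ by an integer; splitting on its sign moves the multiple of `m` to the
  -- side where the identity lives in `ℕ`.
  %ℕ-unique : ∀ m .{{_ : NonZero m}} i a k → i ≡ + a ℤ.+ k ℤ.* + m → i %ℕ m ≡ a ℕ.% m
  %ℕ-unique m i a k i≡ = trans (sym (ℕ.m<n⇒m%n≡m (n%ℕd<d i m))) (go (k ℤ.- i /ℕ m) refl)
    where
    open ≡-Reasoning
    r : ℕ
    r = i %ℕ m
    shift : ∀ r a k c m → r ℤ.+ c ℤ.* m ≡ a ℤ.+ k ℤ.* m → r ≡ a ℤ.+ (k ℤ.- c) ℤ.* m
    shift r a k c m eq = trans (lhs r c m) (trans (cong (ℤ._- c ℤ.* m) eq) (rhs a k c m))
      where
      lhs : ∀ r c m → r ≡ r ℤ.+ c ℤ.* m ℤ.- c ℤ.* m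
      lhs = ℤ-Solver.solve-∀
      rhs : ∀ a k c m → a ℤ.+ k ℤ.* m ℤ.- c ℤ.* m ≡ a ℤ.+ (k ℤ.- c) ℤ.* m
      rhs = ℤ-Solver.solve-∀
    r≡ : + r ≡ + a ℤ.+ (k ℤ.- i /ℕ m) ℤ.* + m
    r≡ = shift (+ r) (+ a) k (i /ℕ m) (+ m) (trans (sym (a≡a%ℕn+[a/ℕn]*n i m)) i≡)
    go : ∀ e → e ≡ k ℤ.- i /ℕ m → r ℕ.% m ≡ a ℕ.% m
    go (+ n) e≡ = trans (cong (ℕ._% m) (ℤ.+-injective (begin
      + r                        ≡⟨ r≡ ⟩
      + a ℤ.+ (k ℤ.- i /ℕ m) ℤ.* + m  ≡⟨ cong (λ e → + a ℤ.+ e ℤ.* + m) e≡ ⟨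
      + a ℤ.+ + n ℤ.* + m        ≡⟨ cong (λ u → + a ℤ.+ u) (ℤ.pos-* n m) ⟨
      + (a ℕ.+ n ℕ.* m)          ∎))) (ℕ.[m+kn]%n≡m%n a n m)
    go -[1+ n ] e≡ = sym (trans (cong (ℕ._% m) (ℤ.+-injective (begin
      + a                        ≡⟨ flip (+ a) (ℤ.+ suc n) (+ m) ⟩
      + a ℤ.+ -[1+ n ] ℤ.* + m ℤ.+ + suc n ℤ.* + m
                                 ≡⟨ cong (λ e → + a ℤ.+ e ℤ.* + m ℤ.+ + suc n ℤ.* + m) e≡ ⟩
      + a ℤ.+ (k ℤ.- i /ℕ m) ℤ.* + m ℤ.+ + suc n ℤ.* + m
                                 ≡⟨ cong₂ ℤ._+_ r≡ (ℤ.pos-* (suc n) m) ⟨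
      + (r ℕ.+ suc n ℕ.* m)      ∎))) (ℕ.[m+kn]%n≡m%n r (suc n) m))
      where
      flip : ∀ a n m → a ≡ a ℤ.+ ℤ.- n ℤ.* m ℤ.+ n ℤ.* m
      flip = ℤ-Solver.solve-∀

open CoveringBound using (module PairCounts; log₂√; missed*D≤)
open RealEstimates
open RationalLemmas
open ReciprocalLemmas
import Data.Nat.Base as ℕ
open import Data.Nat.Base using (ℕ; suc; NonZero; _≤_)
import Data.Nat.Properties as ℕ
import Data.Nat.DivMod as ℕ
open import Data.Nat.Primality using (Prime; prime⇒nonZero)
open import Data.Integer.Base as ℤ using (ℤ; +_)
import Data.Integer.Properties as ℤ
open import Data.Integer.DivMod using (_%ℕ_; _/ℕ_; a≡a%ℕn+[a/ℕn]*n)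
import Data.Integer.Tactic.RingSolver as ℤ-Solver
open import Data.Rational.Base as ℚ hiding (NonZero; _≤_; floor)
open import Data.Rational.Properties as ℚ hiding (_≟_)
open import Data.Rational.Literals using (fromℤ)
open import Data.Rational.Solver using (module +-*-Solver)
open +-*-Solver
open import Data.Fin.Base as Fin using (Fin; toℕ)
import Data.Fin.Properties as Fin
open import Data.Fin.Subset using (Subset) renaming (∣_∣ to card)
open import Data.Fin.Subset.Properties using (∣p∣≤n)
open import Data.Product.Base using (∃; _×_; _,_; proj₁; proj₂)
open import Function.Bundles using (Equivalence)
open import Relation.Binary.PropositionalEquality

-- Transfer to residue classes and to the relative error

residue : (m : ℕ) → .{{NonZero m}} → ℤ → ℕ
residue m S = (S ℤ.+ + 1) %ℕ m

-- The interval length dominates D X l factor by factor: D ≤ Δ, X ≤ √m, 1 ≤ √(m/φ(m)) and l ≤ log m,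
-- for the rational approximations from index `N` on.
products⊇ : ∀ m .{{_ : NonZero m}} Δ S {D l N q j} →
  (∀ n → N ≤ n → fromℕ D ℚ.≤ seq Δ n) → 2 ℕ.^ l ≤ isqrt m →
  Prime q → q ≤ isqrt m → j ℕ.< D ℕ.* isqrt m ℕ.* l →
  Products m Δ S (PairCounts.ρ m (residue m S) 0 (q , j))
products⊇ m Δ S {D} {l} {N} {q} {j} D≤Δ 2ˡ≤√m q-prime q≤√m j<H =
  q , y , (ℕ.>-nonZero⁻¹ q {{prime⇒nonZero q-prime}} , q≤ʳ√m , q-prime) , (S+1≤y , y≤ʳ) , congruence
  where
  open ℚ.≤-Reasoning
  s X : ℕ
  s = residue m S
  X = isqrt m
  y : ℤ
  -- `j` starts at 0 and `y` at S + 1, so `j < H` is exactly y ≤ S + H.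
  y = S ℤ.+ + suc j
  S+1≤y : S ℤ.+ + 1 ℤ.≤ y
  S+1≤y = ℤ.+-monoʳ-≤ S (ℤ.+≤+ (ℕ.s≤s ℕ.z≤n))
  ≤√m : ∀ {a} → a ≤ X → ∀ n → fromℕ a ℚ.≤ seq (√ (ℕ→ℝ m)) n
  ≤√m {a} a≤X n = ≤-√ a (ℕ→ℝ m) n (ℚ.≤-trans (≤-reflexive (sym (fromℕ-* a a)))
    (fromℕ-mono (ℕ.≤-trans (ℕ.*-mono-≤ a≤X a≤X) (isqrt-lower m))))
  q≤ʳ√m : ℕ→ℝ q ≤ʳ √ (ℕ→ℝ m)
  q≤ʳ√m ε 0<ε = 0 , λ n _ → ℚ.≤-trans (≤√m q≤√m n) (p≤p+q (<⇒≤ 0<ε))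
  H≤ : ∀ n → N ≤ n → fromℕ (D ℕ.* X ℕ.* l) ℚ.≤
    seq Δ n * seq (√ (ℕ→ℝ m)) n * seq (√ (fromℚ (m/φ[m] m))) n * seq (log m) n
  H≤ n N≤n = begin
    fromℕ (D ℕ.* X ℕ.* l)            ≡⟨ trans (fromℕ-* (D ℕ.* X) l) (cong (_* fromℕ l) (fromℕ-* D X)) ⟩
    fromℕ D * fromℕ X * fromℕ l      ≡⟨ cong (_* fromℕ l) (*-identityʳ (fromℕ D * fromℕ X)) ⟨
    fromℕ D * fromℕ X * 1ℚ * fromℕ l
      ≤⟨ *-mono-≤-nonNeg 0≤DX1 (ℚ.≤-trans (0≤fromℕ l) l≤log)
           (*-mono-≤-nonNeg 0≤DX (ℚ.≤-trans (0≤fromℕ 1) 1≤√)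
             (*-mono-≤-nonNeg (0≤fromℕ D) (ℚ.≤-trans (0≤fromℕ X) (≤√m ℕ.≤-refl n))
               (D≤Δ n N≤n) (≤√m ℕ.≤-refl n)) 1≤√) l≤log ⟩
    seq Δ n * seq (√ (ℕ→ℝ m)) n * seq (√ (fromℚ (m/φ[m] m))) n * seq (log m) n ∎
    where
    0≤DX : 0ℚ ℚ.≤ fromℕ D * fromℕ X
    0≤DX = *-nonNeg (0≤fromℕ D) (0≤fromℕ X)
    0≤DX1 : 0ℚ ℚ.≤ fromℕ D * fromℕ X * 1ℚ
    0≤DX1 = *-nonNeg 0≤DX (0≤fromℕ 1)
    1≤√ : 1ℚ ℚ.≤ seq (√ (fromℚ (m/φ[m] m))) n
    1≤√ = ≤-√ 1 (fromℚ (m/φ[m] m)) n (1≤m/φ[m] m)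
    l≤log : fromℕ l ℚ.≤ seq (log m) n
    l≤log = ≤-log m l (ℕ.≤-trans (ℕ.*-mono-≤ 2ˡ≤√m 2ˡ≤√m) (isqrt-lower m)) n
  y≤ʳ : ℤ→ℝ y ≤ʳ ℤ→ℝ S +ʳ Δ *ʳ √ (ℕ→ℝ m) *ʳ √ (fromℚ (m/φ[m] m)) *ʳ log m
  y≤ʳ ε 0<ε = N , λ n N≤n → begin
    fromℤ (S ℤ.+ + suc j)           ≡⟨ fromℤ-+ S (+ suc j) ⟩
    fromℤ S + fromℕ (suc j)         ≤⟨ +-monoʳ-≤ (fromℤ S) (ℚ.≤-trans (fromℕ-mono j<H) (H≤ n N≤n)) ⟩
    fromℤ S + seq Δ n * seq (√ (ℕ→ℝ m)) n * seq (√ (fromℚ (m/φ[m] m))) n * seq (log m) n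
                                    ≤⟨ p≤p+q (<⇒≤ 0<ε) ⟩
    fromℤ S + seq Δ n * seq (√ (ℕ→ℝ m)) n * seq (√ (fromℚ (m/φ[m] m))) n * seq (log m) n + ε ∎
  t : ℤ
  t = (S ℤ.+ + 1) /ℕ m
  congruence : (+ q ℤ.* y) %ℕ m ≡ toℕ (PairCounts.ρ m s 0 (q , j))
  congruence = trans (%ℕ-unique m (+ q ℤ.* y) (q ℕ.* (s ℕ.+ j)) (+ q ℤ.* t) qy≡)
    (sym (Fin.toℕ-fromℕ< (ℕ.m%n<n (q ℕ.* (s ℕ.+ j)) m)))
    where
    regroup : ∀ S j → S ℤ.+ (+ 1 ℤ.+ j) ≡ S ℤ.+ + 1 ℤ.+ j
    regroup = ℤ-Solver.solve-∀
    distribute : ∀ q s t m j → q ℤ.* (s ℤ.+ t ℤ.* m ℤ.+ j) ≡ q ℤ.* (s ℤ.+ j) ℤ.+ q ℤ.* t ℤ.* m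
    distribute = ℤ-Solver.solve-∀
    qy≡ : + q ℤ.* y ≡ + (q ℕ.* (s ℕ.+ j)) ℤ.+ + q ℤ.* t ℤ.* + m
    qy≡ = trans (cong (+ q ℤ.*_) (trans (regroup S (+ j))
        (cong (ℤ._+ + j) (a≡a%ℕn+[a/ℕn]*n (S ℤ.+ + 1) m))))
      (trans (distribute (+ q) (+ s) t (+ m) (+ j))
        (cong (ℤ._+ + q ℤ.* t ℤ.* + m) (sym (ℤ.pos-* q (s ℕ.+ j)))))

module RelativeError (K m : ℕ) .{{_ : NonZero m}} (A : Subset m) (Δ : ℝ) (D : ℕ) (1≤D : 1 ≤ D) (N₀ : ℕ)
         (bounds : ∀ n → N₀ ≤ n → fromℕ D ℚ.≤ seq Δ n × seq Δ n ℚ.≤ fromℕ (4 ℕ.* D))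
         (few : (m ℕ.∸ card A) ℕ.* D ≤ K ℕ.* m) where

  private
    missed : ℕ
    missed = m ℕ.∸ card A

  open ℚ.≤-Reasoning
  1≤x : ∀ n → N₀ ≤ n → 1ℚ ℚ.≤ seq Δ n
  1≤x n N₀≤n = ℚ.≤-trans (fromℕ-mono 1≤D) (proj₁ (bounds n N₀≤n))
  0<Δ : 0ʳ <ʳ Δ
  0<Δ = 1ℚ , positive⁻¹ 1ℚ , N₀ , 1≤x
  -- `e` is the proportion of classes missed; the error term can then be the constant -e, making the
  -- size formula exact.
  r e : ℚ
  r = + 1 / m
  e = fromℕ missed * r
  rm : r * fromℕ m ≡ 1ℚ
  rm = /-* (+ 1) m
  0<m : 0ℚ ℚ.< fromℕ m
  0<m = <-≤-trans (positive⁻¹ 1ℚ) (fromℕ-mono (ℕ.>-nonZero⁻¹ m))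
  0≤r : 0ℚ ℚ.≤ r
  0≤r = *-cancelʳ-≤-pos (fromℕ m) {{positive 0<m}} (ℚ.≤-trans (≤-reflexive (*-zeroˡ (fromℕ m)))
    (ℚ.≤-trans (0≤fromℕ 1) (≤-reflexive (sym rm))))
  size≡ : (1ℚ - e) * fromℕ m ≡ fromℕ (card A)
  size≡ = begin-equality
    (1ℚ - fromℕ missed * r) * fromℕ m
      ≡⟨ solve 3 (λ k r m → (con 1ℚ :- k :* r) :* m := m :- k :* (r :* m)) refl (fromℕ missed) r (fromℕ m) ⟩
    fromℕ m - fromℕ missed * (r * fromℕ m)
      ≡⟨ cong₂ (λ u v → u - fromℕ missed * v)
           (trans (cong fromℕ (sym (ℕ.m+[n∸m]≡n (∣p∣≤n A)))) (fromℕ-+ (card A) missed)) rm ⟩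
    fromℕ (card A) + fromℕ missed - fromℕ missed * 1ℚ
      ≡⟨ solve 2 (λ a k → a :+ k :- k :* con 1ℚ := a) refl (fromℕ (card A)) (fromℕ missed) ⟩
    fromℕ (card A) ∎
  size : ℕ→ℝ (card A) ≃ʳ (1ʳ +ʳ fromℚ (- e)) *ʳ ℕ→ℝ m
  size ε 0<ε = 0 , λ n _ → begin
    ∣ fromℕ (card A) - (1ℚ - e) * fromℕ m ∣   ≡⟨ cong (λ u → ∣ fromℕ (card A) - u ∣) size≡ ⟩
    ∣ fromℕ (card A) - fromℕ (card A) ∣       ≡⟨ cong ∣_∣ (+-inverseʳ (fromℕ (card A))) ⟩
    0ℚ                                        ≤⟨ <⇒≤ 0<ε ⟩
    ε                                         ∎
  e*4D≤4K : e * fromℕ (4 ℕ.* D) ℚ.≤ fromℕ (4 ℕ.* K)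
  e*4D≤4K = begin
    fromℕ missed * r * fromℕ (4 ℕ.* D)
      ≡⟨ solve 3 (λ k r d → k :* r :* d := k :* d :* r) refl (fromℕ missed) r (fromℕ (4 ℕ.* D)) ⟩
    fromℕ missed * fromℕ (4 ℕ.* D) * r
      ≡⟨ cong (_* r) (fromℕ-* missed (4 ℕ.* D)) ⟨
    fromℕ (missed ℕ.* (4 ℕ.* D)) * r
      ≤⟨ *-monoʳ-≤-nonNeg r {{nonNegative 0≤r}} (fromℕ-mono 4few) ⟩
    fromℕ (4 ℕ.* K ℕ.* m) * r
      ≡⟨ cong (_* r) (fromℕ-* (4 ℕ.* K) m) ⟩
    fromℕ (4 ℕ.* K) * fromℕ m * r
      ≡⟨ solve 3 (λ k m r → k :* m :* r := k :* (r :* m)) refl (fromℕ (4 ℕ.* K)) (fromℕ m) r ⟩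
    fromℕ (4 ℕ.* K) * (r * fromℕ m)
      ≡⟨ cong (fromℕ (4 ℕ.* K) *_) rm ⟩
    fromℕ (4 ℕ.* K) * 1ℚ
      ≡⟨ *-identityʳ (fromℕ (4 ℕ.* K)) ⟩
    fromℕ (4 ℕ.* K) ∎
    where
    4few : missed ℕ.* (4 ℕ.* D) ≤ 4 ℕ.* K ℕ.* m
    4few = ℕ.≤-trans (ℕ.≤-reflexive (trans (sym (ℕ.*-assoc missed 4 D))
        (trans (cong (ℕ._* D) (ℕ.*-comm missed 4)) (ℕ.*-assoc 4 missed D))))
      (ℕ.≤-trans (ℕ.*-monoʳ-≤ 4 few) (ℕ.≤-reflexive (sym (ℕ.*-assoc 4 K m))))
  0≤e : 0ℚ ℚ.≤ e
  0≤e = *-nonNeg (0≤fromℕ missed) 0≤r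
  -- The upper bound x ≤ 4 D converts 1/D into 1/Δ: e x ≤ e · 4 D ≤ 4 K, and multiplying by the
  -- inverse of `x` isolates `e`.
  error : ∣ fromℚ (- e) ∣ʳ ≤ʳ ℕ→ℝ (4 ℕ.* K) *ʳ Δ ⁻¹[ 0<Δ ]
  error ε 0<ε = N₀ , λ n N₀≤n →
    let x = seq Δ n
        i = recip₀ x
        0<x = <-≤-trans (positive⁻¹ 1ℚ) (1≤x n N₀≤n)
    in begin
    ∣ - e ∣                         ≡⟨ trans (∣-p∣≡∣p∣ e) (0≤p⇒∣p∣≡p 0≤e) ⟩
    e                               ≡⟨ *-identityʳ e ⟨
    e * 1ℚ                          ≡⟨ cong (e *_) (recip₀-* 0<x) ⟨
    e * (x * i)                     ≡⟨ *-assoc e x i ⟨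
    e * x * i                       ≤⟨ *-monoʳ-≤-nonNeg i {{nonNegative (recip₀-nonNeg 0<x)}}
                                         (*-monoˡ-≤-nonNeg e {{nonNegative 0≤e}} (proj₂ (bounds n N₀≤n))) ⟩
    e * fromℕ (4 ℕ.* D) * i         ≤⟨ *-monoʳ-≤-nonNeg i {{nonNegative (recip₀-nonNeg 0<x)}} e*4D≤4K ⟩
    fromℕ (4 ℕ.* K) * i             ≤⟨ p≤p+q (<⇒≤ 0<ε) ⟩
    fromℕ (4 ℕ.* K) * i + ε         ∎

theorem6 : (Δ : (m : ℕ) → .{{NonZero m}} → ℝ) →
    TendsToInfinity Δ →
    ∃ λ (C : ℝ) → ∃ λ (M : ℕ) →
    ∀ (m : ℕ) → .{{_ : NonZero m}} → M ≤ m →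
    ∀ (S : ℤ) (N : ℕ) → HasSize (Products m (Δ m) S) N →
    ∃ λ (0<Δ : 0ʳ <ʳ Δ m) → ∃ λ (E : ℝ) →
    ℕ→ℝ N ≃ʳ (1ʳ +ʳ E) *ʳ ℕ→ℝ m × ∣ E ∣ʳ ≤ʳ C *ʳ Δ m ⁻¹[ 0<Δ ]
theorem6 Δ Δ→∞ = ℕ→ℝ (4 ℕ.* K) , M₁ ℕ.⊔ M₂ , main
  where
  K M₁ M₂ : ℕ
  K = 4 ℕ.* 32 ℕ.* 6
  -- Beyond `M₁` one has Δ ≥ 3, which `D` requires; beyond `M₂` = 4^10 one has l ≥ 10, which the
  -- prime selection requires.
  M₁ = proj₁ (Δ→∞ (ℕ→ℝ 3))
  M₂ = 2 ℕ.^ 10 ℕ.* 2 ℕ.^ 10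
  main : ∀ (m : ℕ) → .{{_ : NonZero m}} → M₁ ℕ.⊔ M₂ ≤ m →
    ∀ (S : ℤ) (N : ℕ) → HasSize (Products m (Δ m) S) N →
    ∃ λ (0<Δ : 0ʳ <ʳ Δ m) → ∃ λ (E : ℝ) →
    ℕ→ℝ N ≃ʳ (1ʳ +ʳ E) *ʳ ℕ→ℝ m × ∣ E ∣ʳ ≤ʳ ℕ→ℝ (4 ℕ.* K) *ʳ Δ m ⁻¹[ 0<Δ ]
  main m M≤m S N (A , A⇔ , refl) =
    let D , 1≤D , N₀ , bounds =
          eventualBounds (Δ m) (proj₂ (Δ→∞ (ℕ→ℝ 3)) m (ℕ.≤-trans (ℕ.m≤m⊔n M₁ M₂) M≤m))
        l , 10≤l , 2ˡ≤√m , √m<2ˡ⁺¹ = log₂√ 10 m (ℕ.≤-trans (ℕ.m≤n⊔m M₁ M₂) M≤m)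
        few = missed*D≤ m (residue m S) D l 1≤D 10≤l 2ˡ≤√m √m<2ˡ⁺¹ A λ q-prime q≤X j<H →
          Equivalence.from (A⇔ _) (products⊇ m (Δ m) S {D} {l} (λ n N₀≤n → proj₁ (bounds n N₀≤n))
            2ˡ≤√m q-prime q≤X j<H)
        open RelativeError K m A (Δ m) D 1≤D N₀ bounds few
    in 0<Δ , fromℚ (- e) , size , error
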